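{- Let $L_{n,j}$, $D_{n,j}$, $U_{n,j}$ denote the total number of levels, descents, and ascents, respectively, over all members of $I_{n,j}$. Then $$\sum_{n\ge1}\sum_{j=1}^nL_{n,j}y^j\frac{x^n}{n!}=xy+\frac{2(xy-y-1)\ln(1-xy)-2y(x-2)\ln(1-x)-y\left(\ln^2(1-xy)-\ln^2(1-x)\right)}{2(1-y)},$$ $$\sum_{n\ge1}\sum_{j=1}^nD_{n,j}y^j\frac{x^n}{n!}=\frac{xy}{2(1-y)}\left(\frac{3x-2}{1-x}-\frac{xy^2}{1-xy}\right)+\frac{(1-xy)\ln(1-xy)-y(2-x-y)\ln(1-x)}{(1-y)^2}+\frac{y\left(\ln^2(1-xy)-\ln^2(1-x)\right)}{2(1-y)},$$ $$\sum_{n\ge1}\sum_{j=1}^nU_{n,j}y^j\frac{x^n}{n!}=\frac{xy}{2(1-y)}\left(\frac{2-x}{1-x}-\frac{xy^2}{1-xy}\right)+\frac{y(1-xy)}{(1-y)^2}\ln\left(\frac{1-x}{1-xy}\right).$$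
   Context: An inversion sequence of length $n$ is a sequence $\rho=\rho_1\cdots\rho_n$ of integers with $1\le \rho_i\le i$ for all $i$; $I_{n,j}$ is the set of those of length $n$ with last letter $j$. A level, descent, or ascent of $\rho$ is an index $i\in[n-1]$ with $\rho_i=\rho_{i+1}$, $\rho_i>\rho_{i+1}$, or $\rho_i<\rho_{i+1}$, respectively. -}

module Defs where

open import Data.Nat.Base as ℕ using (ℕ; zero; suc; NonZero; _!)
import Data.Nat.Properties as ℕ
open import Data.Integer.Base as ℤ using (+_; -1ℤ)
open import Data.Rational.Base as ℚ using (ℚ; 0ℚ; 1ℚ)
import Data.Rational.Properties as ℚ
open import Data.Bool.Base using (if_then_else_)
open import Data.Fin.Base using (Fin; zero; suc; toℕ; fromℕ; inject₁)
open import Data.Fin.Properties using (toℕ-fromℕ; toℕ-inject₁)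
open import Data.Fin.Relation.Unary.Top using (view; ‵fromℕ; ‵inject₁)
open import Data.List.Base as List using (List; allFin; cartesianProductWith; filter; length; upTo)
open import Data.List.Membership.Propositional using (_∈_)
open import Data.List.Membership.Propositional.Properties using (∈-cartesianProductWith⁺; ∈-cartesianProductWith⁻; ∈-filter⁺; ∈-filter⁻; ∈-map⁺; ∈-map⁻; ∈-upTo⁺; ∈-upTo⁻)
open import Data.List.Relation.Unary.Any using (here)
open import Data.List.Relation.Unary.All as All using ()
open import Data.List.Relation.Unary.AllPairs using ([]; _∷_)
open import Data.List.Relation.Unary.Unique.Propositional using (Unique)
open import Data.List.Relation.Unary.Unique.Propositional.Properties using (cartesianProductWith⁺; filter⁺; map⁺; upTo⁺)
open import Data.Product.Base using (_×_; _,_)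
open import Data.Nat.ListAction using (sum)
open import Data.Vec.Base using (Vec; []; _∷_; _∷ʳ_; initLast; last; lookup)
open import Data.Vec.Properties using (∷ʳ-injective)
open import Function.Bundles using (_⇔_; mk⇔)
open import Relation.Binary.PropositionalEquality using (_≡_; refl; sym; subst₂)
open import Relation.Nullary.Decidable using (True)

------------------------------------------------------------------------
-- Inversion sequences

-- The letter ρ_i of the text is lookup ρ at the index of value i - 1.
IsInversionSequence : ∀ {n} → Vec ℕ n → Set
IsInversionSequence {n} ρ =
  (i : Fin n) → 1 ℕ.≤ lookup ρ i × lookup ρ i ℕ.≤ suc (toℕ i)

inversionSequences : ∀ n → List (Vec ℕ n)
inversionSequences zero    = List.[ [] ]
inversionSequences (suc n) =
  cartesianProductWith _∷ʳ_ (inversionSequences n) (List.map suc (upTo (suc n)))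

I : ∀ n .{{_ : NonZero n}} → ℕ → List (Vec ℕ n)
I (suc n) j = filter (λ ρ → last ρ ℕ.≟ j) (inversionSequences (suc n))

private
  lookup-∷ʳ-inject₁ : ∀ {n} (ρ : Vec ℕ n) a i → lookup (ρ ∷ʳ a) (inject₁ i) ≡ lookup ρ i
  lookup-∷ʳ-inject₁ (_ ∷ ρ) a zero    = refl
  lookup-∷ʳ-inject₁ (_ ∷ ρ) a (suc i) = lookup-∷ʳ-inject₁ ρ a i

  lookup-∷ʳ-fromℕ : ∀ {n} (ρ : Vec ℕ n) a → lookup (ρ ∷ʳ a) (fromℕ n) ≡ a
  lookup-∷ʳ-fromℕ []      a = refl
  lookup-∷ʳ-fromℕ (_ ∷ ρ) a = lookup-∷ʳ-fromℕ ρ a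

  Bounded : ℕ → ℕ → Set
  Bounded b a = 1 ℕ.≤ a × a ℕ.≤ suc b

  ∈-range⁺ : ∀ {b a} → Bounded b a → a ∈ List.map suc (upTo (suc b))
  ∈-range⁺ {a = suc a} (_ , a<b) = ∈-map⁺ suc (∈-upTo⁺ a<b)

  ∈-range⁻ : ∀ {b a} → a ∈ List.map suc (upTo (suc b)) → Bounded b a
  ∈-range⁻ p with ∈-map⁻ suc p
  ... | _ , q , refl = ℕ.s≤s ℕ.z≤n , ∈-upTo⁻ q

  sound : ∀ n {ρ : Vec ℕ n} → ρ ∈ inversionSequences n → IsInversionSequence ρ
  sound zero    p ()
  sound (suc n) p i
    with ∈-cartesianProductWith⁻ _∷ʳ_ (inversionSequences n) (List.map suc (upTo (suc n))) p
  ... | σ , a , σ∈ , a∈ , refl with view i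
  ...   | ‵fromℕ     =
    subst₂ Bounded (sym (toℕ-fromℕ n)) (sym (lookup-∷ʳ-fromℕ σ a)) (∈-range⁻ a∈)
  ...   | ‵inject₁ k =
    subst₂ Bounded (sym (toℕ-inject₁ k)) (sym (lookup-∷ʳ-inject₁ σ a k)) (sound n σ∈ k)

  complete : ∀ n {ρ : Vec ℕ n} → IsInversionSequence ρ → ρ ∈ inversionSequences n
  complete zero    {[]} _ = here refl
  complete (suc n) {ρ}  p with initLast ρ
  ... | σ , a , refl = ∈-cartesianProductWith⁺ _∷ʳ_
    (complete n λ k → subst₂ Bounded (toℕ-inject₁ k) (lookup-∷ʳ-inject₁ σ a k) (p (inject₁ k)))
    (∈-range⁺ (subst₂ Bounded (toℕ-fromℕ n) (lookup-∷ʳ-fromℕ σ a) (p (fromℕ n))))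

  unique : ∀ n → Unique (inversionSequences n)
  unique zero    = All.[] ∷ []
  unique (suc n) = cartesianProductWith⁺ _∷ʳ_ (∷ʳ-injective _ _) (unique n)
    (map⁺ ℕ.suc-injective (upTo⁺ (suc n)))

∈-I : ∀ n j {ρ : Vec ℕ (suc n)} → ρ ∈ I (suc n) j ⇔ (IsInversionSequence ρ × last ρ ≡ j)
∈-I n j = mk⇔
  (λ p → let q , r = ∈-filter⁻ (λ ρ → last ρ ℕ.≟ j) {xs = inversionSequences (suc n)} p
         in sound (suc n) q , r)
  (λ (q , r) → ∈-filter⁺ (λ ρ → last ρ ℕ.≟ j) (complete (suc n) q) r)

I-unique : ∀ n j → Unique (I (suc n) j)
I-unique n j = filter⁺ (λ ρ → last ρ ℕ.≟ j) (unique (suc n))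

levels descents ascents : ∀ {n} → Vec ℕ (suc n) → ℕ
levels   {n} ρ = length (filter (λ i → lookup ρ (inject₁ i) ℕ.≟  lookup ρ (suc i)) (allFin n))
descents {n} ρ = length (filter (λ i → lookup ρ (inject₁ i) ℕ.>? lookup ρ (suc i)) (allFin n))
ascents  {n} ρ = length (filter (λ i → lookup ρ (inject₁ i) ℕ.<? lookup ρ (suc i)) (allFin n))

L D U : ∀ n .{{_ : NonZero n}} → ℕ → ℕ
L n@(suc _) j = sum (List.map levels   (I n j))
D n@(suc _) j = sum (List.map descents (I n j))
U n@(suc _) j = sum (List.map ascents  (I n j))

------------------------------------------------------------------------
-- Formal power series in x and y over ℚ

-- f n m is the coefficient of xⁿ yᵐ.
Series : Set
Series = ℕ → ℕ → ℚ

infix  4 _≈_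
infixl 6 _+_ _-_
infixl 7 _*_ _/_
infixr 8 _^_
infix  9 #_

_≈_ : Series → Series → Set
f ≈ g = ∀ n m → f n m ≡ g n m

-- f 0 + f 1 + ⋯ + f n
∑≤ : ℕ → (ℕ → ℚ) → ℚ
∑≤ zero    f = f 0
∑≤ (suc n) f = ∑≤ n f ℚ.+ f (suc n)

const : ℚ → Series
const c zero    zero    = c
const c zero    (suc _) = 0ℚ
const c (suc _) _       = 0ℚ

#_ : ℕ → Series
# k = const (+ k ℚ./ 1)

x : Series
x 1 0 = 1ℚ
x _ _ = 0ℚ

y : Series
y 0 1 = 1ℚ
y _ _ = 0ℚ

_+_ _-_ _*_ : Series → Series → Series
(f + g) n m = f n m ℚ.+ g n m
(f - g) n m = f n m ℚ.- g n m
(f * g) n m = ∑≤ n λ i → ∑≤ m λ j → f i j ℚ.* g (n ℕ.∸ i) (m ℕ.∸ j)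

_^_ : Series → ℕ → Series
f ^ zero  = # 1
f ^ suc k = f * f ^ k

-- ∑ₖ aₖ hᵏ for h with constant term 0: hᵏ has no terms of total degree
-- less than k, so only k ≤ n + m contribute to the coefficient of xⁿ yᵐ.
compose : (ℕ → ℚ) → Series → Series
compose a h n m = ∑≤ (n ℕ.+ m) λ k → a k ℚ.* (h ^ k) n m

-- With c the constant term of g, 1/g = (1/c) ∑ₖ (1 - g/c)ᵏ.
inverse : (g : Series) .{{_ : ℚ.NonZero (g 0 0)}} → Series
inverse g = const c⁻¹ * compose (λ _ → 1ℚ) (# 1 - const c⁻¹ * g)
  where c⁻¹ = ℚ.1/ (g 0 0)

_/_ : (f g : Series) .{{_ : ℚ.NonZero (g 0 0)}} → Series
f / g = f * inverse g

-- ln (1 + h) = ∑ₖ≥₁ (-1)ᵏ⁻¹ hᵏ / k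
lnCoefficient : ℕ → ℚ
lnCoefficient zero    = 0ℚ
lnCoefficient (suc k) = (-1ℤ ℤ.^ k) ℚ./ suc k

ln : (f : Series) {_ : True (f 0 0 ℚ.≟ 1ℚ)} → Series
ln f = compose lnCoefficient (f - # 1)

-- ∑_{n ≥ 1} ∑_{j = 1}^{n} a n j yʲ xⁿ / n!
egf : (∀ n .{{_ : NonZero n}} → ℕ → ℕ) → Series
egf a zero      _         = 0ℚ
egf a (suc _)   zero      = 0ℚ
egf a n@(suc _) j@(suc _) =
  if j ℕ.≤ᵇ n then (ℚ._/_ (+ a n j) (n !) {{n ℕ.!≢0}}) else 0ℚ

{-# OPTIONS --safe #-}
module Submission where

open import Algebra.Bundles using (CommutativeRing)
import Algebra.Construct.Pointwise as Pointwise
import Algebra.Solver.Ring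
open import Algebra.Solver.Ring.AlmostCommutativeRing using (_-Raw-AlmostCommutative⟶_; fromCommutativeRing)
open import Data.Bool.Base using (Bool; true; false; if_then_else_; T)
open import Data.Integer.Base as ℤ using (+_; -1ℤ)
import Data.Integer.Properties as ℤ
import Data.Maybe.Base as Maybe
open import Data.Nat.Base as ℕ using (ℕ; zero; suc; z≤n; s≤s; nonZero; _!)
import Data.Nat.Properties as ℕ
open import Data.Product.Base using (_×_; _,_)
open import Data.Rational.Base as ℚ using (ℚ; 0ℚ; 1ℚ)
import Data.Rational.Properties as ℚ
import Data.Rational.Solver
import Data.Rational.Unnormalised.Base as ℚᵘ
import Data.Rational.Unnormalised.Properties as ℚᵘ
open import Function.Base using (_∘_; id)
open import Relation.Binary.Definitions using (Decidable)
open import Relation.Binary.PropositionalEquality as ≡ using (_≡_; cong; cong₂)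
import Relation.Binary.Reasoning.Setoid
open import Relation.Nullary.Decidable using (does; dec⇒maybe; toWitness)

-- Removing the last letter gives, for a statistic counting adjacent pairs
-- a R b, the recurrence S(n+2, j) = T(n+1) + n! #{a ≤ n+1 : a R j}, where
-- T(n) is the total over all sequences of length n. So T(n)/n! telescopes:
-- its increments are 1/n for levels and 1/2 for ascents, which sums up to
-- expressions in ln (1 - x) and 1/(1 - x). The sum over 1 ≤ j ≤ n turns a
-- series a(x) into y (a(x) - a(xy)) / (1 - y), which is where ln (1 - xy)
-- comes from. Descents follow from levels + descents + ascents = n - 1.
-- Logarithms are handled through the Euler operator θ = x ∂/∂x: ln f is the
-- only series without terms in x⁰ that satisfies f · θ (ln f) = θ f.

-- Divided by (n + 2)!, the recurrence splits a coefficient in two. The total over shorter sequences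
-- becomes the normalised total of length n + 1 divided by n + 2, which is integration. For levels
-- the integrand is (-ln (1 - x) - x)/(1 - x), the source of the squared logarithms. The pair formed
-- by the last two letters carries the weight n!/(n + 2)!, the source of 1/(n (n - 1)). For ascents
-- the number of such pairs grows linearly in j, and summing it over j divides by 1 - y twice.
-- Inverses and logarithms are sums whose cutoff moves with the coefficient, so ring identities do
-- not apply to them directly. Such identities are proved for partial sums with a fixed cutoff and
-- an explicit remainder, which vanishes at the coefficient in question. The closed forms are
-- compared after multiplication by a unit. Logarithms, inverses and row sums then count as
-- independent variables, and the difference of the two sides is given as an explicit combination of
-- their defining relations, which the ring solver checks.

module PowerSeries {c ℓ} (K : CommutativeRing c ℓ) where

  open CommutativeRing K
  open import Algebra.Properties.Semiring.Exp semiring using (_^_; ^-homo-*)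
  open import Algebra.Properties.CommutativeSemigroup +-commutativeSemigroup
    using () renaming (interchange to +-interchange)
  open import Algebra.Properties.CommutativeSemigroup *-commutativeSemigroup
    using (x∙yz≈y∙xz) renaming (interchange to *-interchange)
  open import Relation.Binary.Reasoning.Setoid setoid

  -- Formal power series in one variable over a commutative ring.

  ∑ : ℕ → (ℕ → Carrier) → Carrier
  ∑ zero    f = f 0
  ∑ (suc n) f = ∑ n f + f (suc n)

  ∑-cong : ∀ n {f g} → (∀ {i} → i ℕ.≤ n → f i ≈ g i) → ∑ n f ≈ ∑ n g
  ∑-cong zero    f≈g = f≈g z≤n
  ∑-cong (suc n) f≈g = +-cong (∑-cong n λ i≤n → f≈g (ℕ.m≤n⇒m≤1+n i≤n)) (f≈g ℕ.≤-refl)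

  ∑-distrib-+ : ∀ n f g → ∑ n (λ i → f i + g i) ≈ ∑ n f + ∑ n g
  ∑-distrib-+ zero    f g = refl
  ∑-distrib-+ (suc n) f g =
    trans (+-congʳ (∑-distrib-+ n f g)) (+-interchange _ _ _ _)

  ∑-distribˡ-* : ∀ n a f → ∑ n (λ i → a * f i) ≈ a * ∑ n f
  ∑-distribˡ-* zero    a f = refl
  ∑-distribˡ-* (suc n) a f = trans (+-congʳ (∑-distribˡ-* n a f)) (sym (distribˡ a _ _))

  ∑-zero : ∀ n {f} → (∀ {i} → i ℕ.≤ n → f i ≈ 0#) → ∑ n f ≈ 0#
  ∑-zero zero    f≈0 = f≈0 z≤n
  ∑-zero (suc n) f≈0 =
    trans (+-cong (∑-zero n λ i≤n → f≈0 (ℕ.m≤n⇒m≤1+n i≤n)) (f≈0 ℕ.≤-refl)) (+-identityˡ 0#)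

  ∑-head : ∀ n f → ∑ (suc n) f ≈ f 0 + ∑ n (f ∘ suc)
  ∑-head zero    f = refl
  ∑-head (suc n) f = trans (+-congʳ (∑-head n f)) (+-assoc _ _ _)

  infix  4 _≋_
  infixl 6 _⊕_
  infixl 7 _⊛_

  _≋_ : (f g : ℕ → Carrier) → Set ℓ
  f ≋ g = ∀ n → f n ≈ g n

  _⊕_ _⊛_ : (f g : ℕ → Carrier) → ℕ → Carrier
  (f ⊕ g) n = f n + g n
  (f ⊛ g) n = ∑ n λ i → f i * g (n ℕ.∸ i)

  ⊖_ : (ℕ → Carrier) → ℕ → Carrier
  (⊖ f) n = - f n

  constant : Carrier → ℕ → Carrier
  constant a zero    = a
  constant a (suc _) = 0#

  -- Peeling one term off either end makes the Cauchy product recursive in the degree, so that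
  -- commutativity and associativity follow by induction, without reindexing a double sum.
  ⊛-headˡ : ∀ f g n → (f ⊛ g) (suc n) ≈ f 0 * g (suc n) + ((f ∘ suc) ⊛ g) n
  ⊛-headˡ f g n = ∑-head n λ i → f i * g (suc n ℕ.∸ i)

  ⊛-headʳ : ∀ f g n → (f ⊛ g) (suc n) ≈ (f ⊛ (g ∘ suc)) n + f (suc n) * g 0
  ⊛-headʳ f g n = +-cong
    (∑-cong n λ {i} i≤n → *-congˡ (reflexive (cong g (ℕ.+-∸-assoc 1 i≤n))))
    (*-congˡ (reflexive (cong g (ℕ.n∸n≡0 n))))

  ⊛-cong : ∀ {f f′ g g′} → f ≋ f′ → g ≋ g′ → f ⊛ g ≋ f′ ⊛ g′
  ⊛-cong p q n = ∑-cong n λ {i} _ → *-cong (p i) (q (n ℕ.∸ i))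

  ⊛-comm : ∀ f g → f ⊛ g ≋ g ⊛ f
  ⊛-comm f g zero    = *-comm (f 0) (g 0)
  ⊛-comm f g (suc n) = begin
    (f ⊛ g) (suc n)                            ≈⟨ ⊛-headˡ f g n ⟩
    f 0 * g (suc n) + ((f ∘ suc) ⊛ g) n        ≈⟨ +-comm _ _ ⟩
    ((f ∘ suc) ⊛ g) n + f 0 * g (suc n)        ≈⟨ +-cong (⊛-comm (f ∘ suc) g n) (*-comm _ _) ⟩
    (g ⊛ (f ∘ suc)) n + g (suc n) * f 0        ≈⟨ ⊛-headʳ g f n ⟨
    (g ⊛ f) (suc n)                            ∎

  ⊛-distribˡ : ∀ f g h → f ⊛ (g ⊕ h) ≋ f ⊛ g ⊕ f ⊛ h
  ⊛-distribˡ f g h n =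
    trans (∑-cong n λ _ → distribˡ _ _ _) (∑-distrib-+ n _ _)

  ⊛-distribʳ : ∀ f g h → (g ⊕ h) ⊛ f ≋ g ⊛ f ⊕ h ⊛ f
  ⊛-distribʳ f g h n =
    trans (∑-cong n λ _ → distribʳ _ _ _) (∑-distrib-+ n _ _)

  scalar-⊛ : ∀ a f g → (λ n → a * f n) ⊛ g ≋ λ n → a * (f ⊛ g) n
  scalar-⊛ a f g n =
    trans (∑-cong n λ _ → *-assoc _ _ _) (∑-distribˡ-* n a _)

  constant-⊛ : ∀ a f → constant a ⊛ f ≋ λ n → a * f n
  constant-⊛ a f zero    = refl
  constant-⊛ a f (suc n) = begin
    (constant a ⊛ f) (suc n)                 ≈⟨ ⊛-headˡ (constant a) f n ⟩
    a * f (suc n) + ∑ n (λ i → 0# * f (n ℕ.∸ i)) ≈⟨ +-congˡ (∑-zero n λ _ → zeroˡ _) ⟩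
    a * f (suc n) + 0#                       ≈⟨ +-identityʳ _ ⟩
    a * f (suc n)                            ∎

  ⊛-assoc : ∀ f g h → (f ⊛ g) ⊛ h ≋ f ⊛ (g ⊛ h)
  ⊛-assoc f g h zero    = *-assoc _ _ _
  ⊛-assoc f g h (suc n) = begin
    ((f ⊛ g) ⊛ h) (suc n)
      ≈⟨ ⊛-headˡ (f ⊛ g) h n ⟩
    f 0 * g 0 * h (suc n) + (((f ⊛ g) ∘ suc) ⊛ h) n
      ≈⟨ +-cong (*-assoc _ _ _) (⊛-cong {g = h} (⊛-headˡ f g) (λ _ → refl) n) ⟩
    f 0 * (g 0 * h (suc n)) + (((λ k → f 0 * g (suc k)) ⊕ ((f ∘ suc) ⊛ g)) ⊛ h) n
      ≈⟨ +-congˡ (⊛-distribʳ h _ _ n) ⟩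
    f 0 * (g 0 * h (suc n)) + (((λ k → f 0 * g (suc k)) ⊛ h) n + (((f ∘ suc) ⊛ g) ⊛ h) n)
      ≈⟨ +-congˡ (+-cong (scalar-⊛ (f 0) (g ∘ suc) h n) (⊛-assoc (f ∘ suc) g h n)) ⟩
    f 0 * (g 0 * h (suc n)) + (f 0 * ((g ∘ suc) ⊛ h) n + ((f ∘ suc) ⊛ (g ⊛ h)) n)
      ≈⟨ +-assoc _ _ _ ⟨
    f 0 * (g 0 * h (suc n)) + f 0 * ((g ∘ suc) ⊛ h) n + ((f ∘ suc) ⊛ (g ⊛ h)) n
      ≈⟨ +-congʳ (distribˡ _ _ _) ⟨
    f 0 * (g 0 * h (suc n) + ((g ∘ suc) ⊛ h) n) + ((f ∘ suc) ⊛ (g ⊛ h)) n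
      ≈⟨ +-congʳ (*-congˡ (⊛-headˡ g h n)) ⟨
    f 0 * (g ⊛ h) (suc n) + ((f ∘ suc) ⊛ (g ⊛ h)) n
      ≈⟨ ⊛-headˡ f (g ⊛ h) n ⟨
    (f ⊛ (g ⊛ h)) (suc n) ∎

  ⊛-identityˡ : ∀ f → constant 1# ⊛ f ≋ f
  ⊛-identityˡ f n = trans (constant-⊛ 1# f n) (*-identityˡ _)

  commutativeRing : CommutativeRing c ℓ
  commutativeRing = record
    { Carrier = ℕ → Carrier
    ; _≈_     = _≋_
    ; _+_     = _⊕_
    ; _*_     = _⊛_
    ; -_      = ⊖_
    ; 0#      = λ _ → 0#
    ; 1#      = constant 1#
    ; isCommutativeRing = record
      { isRing = record
        { +-isAbelianGroup = Pointwise.isAbelianGroup ℕ +-isAbelianGroup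
        ; *-cong     = ⊛-cong
        ; *-assoc    = ⊛-assoc
        ; *-identity = ⊛-identityˡ , λ f n → trans (⊛-comm f (constant 1#) n) (⊛-identityˡ f n)
        ; distrib    = ⊛-distribˡ , ⊛-distribʳ
        }
      ; *-comm = ⊛-comm
      }
    }

  -- The substitution x ↦ t x.
  scale : Carrier → (ℕ → Carrier) → ℕ → Carrier
  scale t f n = t ^ n * f n

  scale-⊛ : ∀ t f g → scale t (f ⊛ g) ≋ scale t f ⊛ scale t g
  scale-⊛ t f g n = begin
    t ^ n * (f ⊛ g) n
      ≈⟨ ∑-distribˡ-* n (t ^ n) _ ⟨
    ∑ n (λ i → t ^ n * (f i * g (n ℕ.∸ i)))
      ≈⟨ ∑-cong n (λ {i} i≤n → *-congʳ (trans
           (reflexive (cong (t ^_) (≡.sym (ℕ.m+[n∸m]≡n i≤n))))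
           (^-homo-* t i (n ℕ.∸ i)))) ⟩
    ∑ n (λ i → t ^ i * t ^ (n ℕ.∸ i) * (f i * g (n ℕ.∸ i)))
      ≈⟨ ∑-cong n (λ _ → *-interchange _ _ _ _) ⟩
    (scale t f ⊛ scale t g) n ∎

  var : ℕ → Carrier
  var zero    = 0#
  var (suc n) = constant 1# n

  var-⊛-suc : ∀ f n → (var ⊛ f) (suc n) ≈ f n
  var-⊛-suc f n = trans (⊛-headˡ var f n)
    (trans (+-cong (zeroˡ _) (⊛-identityˡ f n)) (+-identityˡ _))

  module _ (w : ℕ → Carrier) (w-+ : ∀ i j → w (i ℕ.+ j) ≈ w i + w j) where

    weight : (ℕ → Carrier) → ℕ → Carrier
    weight f n = w n * f n

    -- Additivity of `w` gives the Leibniz rule: the weight of n is shared out between the factors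
    -- as i and n - i.
    weight-⊛ : ∀ f g → weight (f ⊛ g) ≋ weight f ⊛ g ⊕ f ⊛ weight g
    weight-⊛ f g n = begin
      w n * (f ⊛ g) n
        ≈⟨ ∑-distribˡ-* n (w n) _ ⟨
      ∑ n (λ i → w n * (f i * g (n ℕ.∸ i)))
        ≈⟨ ∑-cong n (λ {i} i≤n → *-congʳ (trans
             (reflexive (cong w (≡.sym (ℕ.m+[n∸m]≡n i≤n)))) (w-+ i (n ℕ.∸ i)))) ⟩
      ∑ n (λ i → (w i + w (n ℕ.∸ i)) * (f i * g (n ℕ.∸ i)))
        ≈⟨ ∑-cong n (λ _ → trans (distribʳ _ _ _)
             (+-cong (sym (*-assoc _ _ _)) (x∙yz≈y∙xz _ _ _))) ⟩
      ∑ n (λ i → w i * f i * g (n ℕ.∸ i) + f i * (w (n ℕ.∸ i) * g (n ℕ.∸ i)))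
        ≈⟨ ∑-distrib-+ n _ _ ⟩
      (weight f ⊛ g ⊕ f ⊛ weight g) n ∎

open ≡ using (refl; sym; trans; module ≡-Reasoning)
open import Defs

-- Counting adjacent pairs of letters by removal of the last letter.

module Counting where

  open import Data.Fin.Base using (Fin; zero; suc; inject₁)
  open import Data.List.Base using (List; []; _∷_; _++_; map; allFin; tabulate; cartesianProductWith; filter; length; upTo; applyUpTo)
  open import Data.List.Properties using (map-++; map-∘; map-cong)
  open import Data.Nat.ListAction using (sum)
  open import Data.Nat.ListAction.Properties using (sum-++)
  open import Data.Nat.Solver using (module +-*-Solver)
  open import Data.Vec.Base using (Vec; []; _∷_; _∷ʳ_; last; lookup)
  open import Data.Vec.Properties using (last-∷ʳ)
  open import Level using (0ℓ)
  open import Relation.Unary as Unary using (Pred)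
  open import Algebra.Properties.CommutativeSemigroup ℕ.+-commutativeSemigroup
    using () renaming (interchange to +-interchange)

  open ≡-Reasoning

  private
    variable
      X Y Z : Set

  total : List X → (X → ℕ) → ℕ
  total xs f = sum (map f xs)

  total-cong : ∀ (xs : List X) {f g} → (∀ a → f a ≡ g a) → total xs f ≡ total xs g
  total-cong xs f≡g = cong sum (map-cong f≡g xs)

  total-+ : ∀ (xs : List X) f g → total xs (λ a → f a ℕ.+ g a) ≡ total xs f ℕ.+ total xs g
  total-+ []       f g = refl
  total-+ (a ∷ xs) f g =
    trans (cong (f a ℕ.+ g a ℕ.+_) (total-+ xs f g)) (+-interchange (f a) (g a) _ _)

  total-const : ∀ (xs : List X) k → total xs (λ _ → k) ≡ length xs ℕ.* k
  total-const []       k = refl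
  total-const (a ∷ xs) k = cong (k ℕ.+_) (total-const xs k)

  total-* : ∀ (xs : List X) k f → total xs (λ a → k ℕ.* f a) ≡ k ℕ.* total xs f
  total-* []       k f = sym (ℕ.*-zeroʳ k)
  total-* (a ∷ xs) k f =
    trans (cong (k ℕ.* f a ℕ.+_) (total-* xs k f)) (sym (ℕ.*-distribˡ-+ k (f a) (total xs f)))

  total-++ : ∀ (xs ys : List X) f → total (xs ++ ys) f ≡ total xs f ℕ.+ total ys f
  total-++ xs ys f = trans (cong sum (map-++ f xs ys)) (sum-++ (map f xs) (map f ys))

  total-map : ∀ (g : X → Y) xs f → total (map g xs) f ≡ total xs (f ∘ g)
  total-map g xs f = cong sum (sym (map-∘ xs))

  total-cartesianProductWith : ∀ (h : X → Y → Z) xs ys f →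
    total (cartesianProductWith h xs ys) f ≡ total xs λ a → total ys λ b → f (h a b)
  total-cartesianProductWith h []       ys f = refl
  total-cartesianProductWith h (a ∷ xs) ys f =
    trans (total-++ (map (h a) ys) (cartesianProductWith h xs ys) f)
      (cong₂ ℕ._+_ (total-map (h a) ys f) (total-cartesianProductWith h xs ys f))

  total-filter : ∀ {P : Pred X 0ℓ} (P? : Unary.Decidable P) xs f →
    total (filter P? xs) f ≡ total xs λ a → if does (P? a) then f a else 0
  total-filter P? []       f = refl
  total-filter P? (a ∷ xs) f with does (P? a)
  ... | true  = cong (f a ℕ.+_) (total-filter P? xs f)
  ... | false = total-filter P? xs f

  sum< : ℕ → (ℕ → ℕ) → ℕ
  sum< zero    f = 0
  sum< (suc n) f = f 0 ℕ.+ sum< n (f ∘ suc)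

  sum<-const : ∀ n k → sum< n (λ _ → k) ≡ n ℕ.* k
  sum<-const zero    k = refl
  sum<-const (suc n) k = cong (k ℕ.+_) (sum<-const n k)

  letters : ℕ → List ℕ
  letters n = map suc (upTo n)

  total-letters : ∀ n f → total (letters n) f ≡ sum< n (f ∘ suc)
  total-letters n f = trans (total-map suc (upTo n) f) (go id n)
    where
    go : ∀ (g : ℕ → ℕ) n → total (applyUpTo g n) (f ∘ suc) ≡ sum< n (f ∘ suc ∘ g)
    go g zero    = refl
    go g (suc n) = cong (f (suc (g 0)) ℕ.+_) (go (g ∘ suc) n)

  -- `sum<` peels off the index 0, and `does (suc k ℕ.≟ suc m)` reduces to `does (k ℕ.≟ m)`, so the
  -- induction hypothesis is the goal by computation.
  sum<-select : ∀ n m (f : ℕ → ℕ) → sum< n (λ k → if does (k ℕ.≟ m) then f k else 0) ≡ (if m ℕ.<ᵇ n then f m else 0)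
  sum<-select zero    m       f = refl
  sum<-select (suc n) zero    f =
    trans (cong (f 0 ℕ.+_) (trans (sum<-const n 0) (ℕ.*-zeroʳ n))) (ℕ.+-identityʳ (f 0))
  sum<-select (suc n) (suc m) f = sum<-select n m (f ∘ suc)

  total-letters-select : ∀ n m (f : ℕ → ℕ) → m ℕ.< n →
    total (letters n) (λ a → if does (a ℕ.≟ suc m) then f a else 0) ≡ f (suc m)
  total-letters-select n m f m<n = begin
    total (letters n) (λ a → if does (a ℕ.≟ suc m) then f a else 0)
      ≡⟨ total-letters n (λ a → if does (a ℕ.≟ suc m) then f a else 0) ⟩
    sum< n (λ k → if does (k ℕ.≟ m) then f (suc k) else 0)
      ≡⟨ sum<-select n m (f ∘ suc) ⟩
    (if m ℕ.<ᵇ n then f (suc m) else 0)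
      ≡⟨ inRange (m ℕ.<ᵇ n) (ℕ.<⇒<ᵇ m<n) ⟩
    f (suc m) ∎
    where
    open import Data.Bool.Base using (T)
    inRange : ∀ b {k} → T b → (if b then k else 0) ≡ k
    inRange true _ = refl

  length-inversionSequences : ∀ n → length (inversionSequences n) ≡ n !
  length-inversionSequences zero    = refl
  length-inversionSequences (suc n) = begin
    length (inversionSequences (suc n))
      ≡⟨ sym (trans (total-const (inversionSequences (suc n)) 1) (ℕ.*-identityʳ _)) ⟩
    total (inversionSequences (suc n)) (λ _ → 1)
      ≡⟨ total-cartesianProductWith _∷ʳ_ (inversionSequences n) (letters (suc n)) (λ _ → 1) ⟩
    total (inversionSequences n) (λ _ → total (letters (suc n)) (λ _ → 1))
      ≡⟨ total-const (inversionSequences n) _ ⟩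
    length (inversionSequences n) ℕ.* total (letters (suc n)) (λ _ → 1)
      ≡⟨ cong₂ ℕ._*_ (length-inversionSequences n)
           (trans (total-letters (suc n) (λ _ → 1)) (trans (sum<-const (suc n) 1) (ℕ.*-identityʳ (suc n)))) ⟩
    n ! ℕ.* suc n
      ≡⟨ ℕ.*-comm (n !) (suc n) ⟩
    suc n ! ∎

  -- The filter on the last letter keeps exactly one extension of each shorter sequence; `m ≤ n`
  -- makes the letter `suc m` admissible in the last position.
  total-I : ∀ n m f → m ℕ.≤ n → total (I (suc n) (suc m)) f ≡ total (inversionSequences n) λ ρ → f (ρ ∷ʳ suc m)
  total-I n m f m≤n = begin
    total (I (suc n) (suc m)) f
      ≡⟨ total-filter (λ ρ → last ρ ℕ.≟ suc m) (inversionSequences (suc n)) f ⟩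
    total (inversionSequences (suc n)) (λ ρ → if does (last ρ ℕ.≟ suc m) then f ρ else 0)
      ≡⟨ total-cartesianProductWith _∷ʳ_ (inversionSequences n) (letters (suc n)) _ ⟩
    total (inversionSequences n) (λ ρ → total (letters (suc n)) λ a → if does (last (ρ ∷ʳ a) ℕ.≟ suc m) then f (ρ ∷ʳ a) else 0)
      ≡⟨ total-cong (inversionSequences n) (λ ρ → total-cong (letters (suc n)) λ a →
           cong (λ b → if does (b ℕ.≟ suc m) then f (ρ ∷ʳ a) else 0) (last-∷ʳ a ρ)) ⟩
    total (inversionSequences n) (λ ρ → total (letters (suc n)) λ a → if does (a ℕ.≟ suc m) then f (ρ ∷ʳ a) else 0)
      ≡⟨ total-cong (inversionSequences n) (λ ρ → total-letters-select (suc n) m (λ a → f (ρ ∷ʳ a)) (s≤s m≤n)) ⟩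
    total (inversionSequences n) (λ ρ → f (ρ ∷ʳ suc m)) ∎

  module Adjacent {R : ℕ → ℕ → Set} (R? : Decidable R) where

    holds : ℕ → ℕ → ℕ
    holds a b = if does (R? a b) then 1 else 0

    -- At `ℕ._≟_`, `ℕ._>?_` and `ℕ._<?_` this unfolds to `levels`, `descents` and `ascents`, so the
    -- results of the module apply to them without conversion.
    count : ∀ {n} → Vec ℕ (suc n) → ℕ
    count {n} ρ = length (filter (λ i → R? (lookup ρ (inject₁ i)) (lookup ρ (suc i))) (allFin n))

    private
      length-filter-tabulate : ∀ {k n} {P : Pred (Fin n) 0ℓ} (P? : Unary.Decidable P) (f : Fin k → Fin n) →
        length (filter P? (tabulate f)) ≡ length (filter (P? ∘ f) (allFin k))
      length-filter-tabulate = go id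
        where
        -- The inner tabulation `g` is arbitrary because `allFin k` is `tabulate id`, whose tail is
        -- no longer tabulated by `id`.
        go : ∀ {j k n} {P : Pred (Fin n) 0ℓ} (g : Fin j → Fin k) (P? : Unary.Decidable P) (f : Fin k → Fin n) →
          length (filter P? (tabulate (f ∘ g))) ≡ length (filter (P? ∘ f) (tabulate g))
        go {zero}  g P? f = refl
        go {suc j} g P? f with does (P? (f (g zero)))
        ... | true  = cong suc (go (g ∘ suc) P? f)
        ... | false = go (g ∘ suc) P? f

    count-∷ : ∀ {n} a b (ρ : Vec ℕ n) → count (a ∷ b ∷ ρ) ≡ holds a b ℕ.+ count (b ∷ ρ)
    count-∷ {n} a b ρ with does (R? a b)
    ... | true  = cong suc (length-filter-tabulate
      (λ i → R? (lookup (a ∷ b ∷ ρ) (inject₁ i)) (lookup (a ∷ b ∷ ρ) (suc i))) suc)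
    ... | false = length-filter-tabulate
      (λ i → R? (lookup (a ∷ b ∷ ρ) (inject₁ i)) (lookup (a ∷ b ∷ ρ) (suc i))) suc

    count-∷ʳ : ∀ {n} (ρ : Vec ℕ (suc n)) a → count (ρ ∷ʳ a) ≡ count ρ ℕ.+ holds (last ρ) a
    count-∷ʳ (b ∷ [])    a = trans (count-∷ b a []) (ℕ.+-identityʳ (holds b a))
    count-∷ʳ (b ∷ c ∷ ρ) a = begin
      count (b ∷ c ∷ (ρ ∷ʳ a))                                  ≡⟨ count-∷ b c (ρ ∷ʳ a) ⟩
      holds b c ℕ.+ count (c ∷ (ρ ∷ʳ a))                        ≡⟨ cong (holds b c ℕ.+_) (count-∷ʳ (c ∷ ρ) a) ⟩
      holds b c ℕ.+ (count (c ∷ ρ) ℕ.+ holds (last (c ∷ ρ)) a)  ≡⟨ ℕ.+-assoc (holds b c) _ _ ⟨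
      holds b c ℕ.+ count (c ∷ ρ) ℕ.+ holds (last (c ∷ ρ)) a    ≡⟨ cong (ℕ._+ holds (last (c ∷ ρ)) a) (count-∷ b c ρ) ⟨
      count (b ∷ c ∷ ρ) ℕ.+ holds (last (b ∷ c ∷ ρ)) a          ∎

    -- `count` takes nonempty words only; the default value 0 at length 0 becomes the constant term
    -- of the series of normalised totals.
    grandTotal : ℕ → ℕ
    grandTotal zero    = 0
    grandTotal (suc n) = total (inversionSequences (suc n)) count

    private
      -- Each of the `suc n` admissible letters ends exactly n! sequences, one for every sequence of
      -- length n.
      total-last : ∀ n (f : ℕ → ℕ) →
        total (inversionSequences (suc n)) (λ ρ → f (last ρ)) ≡ n ! ℕ.* sum< (suc n) (f ∘ suc)
      total-last n f = begin
        total (inversionSequences (suc n)) (λ ρ → f (last ρ))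
          ≡⟨ total-cartesianProductWith _∷ʳ_ (inversionSequences n) (letters (suc n)) _ ⟩
        total (inversionSequences n) (λ ρ → total (letters (suc n)) λ a → f (last (ρ ∷ʳ a)))
          ≡⟨ total-cong (inversionSequences n) (λ ρ → total-cong (letters (suc n)) λ a → cong f (last-∷ʳ a ρ)) ⟩
        total (inversionSequences n) (λ ρ → total (letters (suc n)) f)
          ≡⟨ total-const (inversionSequences n) _ ⟩
        length (inversionSequences n) ℕ.* total (letters (suc n)) f
          ≡⟨ cong₂ ℕ._*_ (length-inversionSequences n) (total-letters (suc n) f) ⟩
        n ! ℕ.* sum< (suc n) (f ∘ suc) ∎

    total-I-count : ∀ n m → m ℕ.≤ suc n →
      total (I (suc (suc n)) (suc m)) count ≡
      grandTotal (suc n) ℕ.+ n ! ℕ.* sum< (suc n) (λ k → holds (suc k) (suc m))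
    total-I-count n m m≤1+n = begin
      total (I (suc (suc n)) (suc m)) count
        ≡⟨ total-I (suc n) m count m≤1+n ⟩
      total (inversionSequences (suc n)) (λ ρ → count (ρ ∷ʳ suc m))
        ≡⟨ total-cong (inversionSequences (suc n)) (λ ρ → count-∷ʳ ρ (suc m)) ⟩
      total (inversionSequences (suc n)) (λ ρ → count ρ ℕ.+ holds (last ρ) (suc m))
        ≡⟨ total-+ (inversionSequences (suc n)) count _ ⟩
      grandTotal (suc n) ℕ.+ total (inversionSequences (suc n)) (λ ρ → holds (last ρ) (suc m))
        ≡⟨ cong (grandTotal (suc n) ℕ.+_) (total-last n (λ a → holds a (suc m))) ⟩
      grandTotal (suc n) ℕ.+ n ! ℕ.* sum< (suc n) (λ k → holds (suc k) (suc m)) ∎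

    -- Related pairs among the possible last two letters of a sequence of length N + 1: the last
    -- letter has one choice more than the letter before it.
    pairs : ℕ → ℕ
    pairs N = sum< N λ b → sum< (suc N) λ a → holds (suc b) (suc a)

    -- A sequence of length n + 1 has n + 2 extensions, all of which keep its old pairs. Each
    -- related pair of last letters is new in n! of the extensions, since its first letter ends n!
    -- sequences.
    grandTotal-suc : ∀ n →
      grandTotal (suc (suc n)) ≡ suc (suc n) ℕ.* grandTotal (suc n) ℕ.+ n ! ℕ.* pairs (suc n)
    grandTotal-suc n = begin
      total (inversionSequences (suc (suc n))) count
        ≡⟨ total-cartesianProductWith _∷ʳ_ IS letters′ count ⟩
      total IS (λ ρ → total letters′ λ a → count (ρ ∷ʳ a))
        ≡⟨ total-cong IS (λ ρ → total-cong letters′ λ a → count-∷ʳ ρ a) ⟩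
      total IS (λ ρ → total letters′ λ a → count ρ ℕ.+ holds (last ρ) a)
        ≡⟨ total-cong IS (λ ρ → trans (total-+ letters′ (λ _ → count ρ) (holds (last ρ)))
             (cong₂ ℕ._+_ (trans (total-letters (suc (suc n)) (λ _ → count ρ)) (sum<-const (suc (suc n)) (count ρ)))
               (total-letters (suc (suc n)) (holds (last ρ))))) ⟩
      total IS (λ ρ → suc (suc n) ℕ.* count ρ ℕ.+ sum< (suc (suc n)) (λ a → holds (last ρ) (suc a)))
        ≡⟨ total-+ IS _ _ ⟩
      total IS (λ ρ → suc (suc n) ℕ.* count ρ) ℕ.+ total IS (λ ρ → sum< (suc (suc n)) (λ a → holds (last ρ) (suc a)))
        ≡⟨ cong₂ ℕ._+_ (total-* IS (suc (suc n)) count)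
             (total-last n (λ b → sum< (suc (suc n)) (λ a → holds b (suc a)))) ⟩
      suc (suc n) ℕ.* grandTotal (suc n) ℕ.+ n ! ℕ.* pairs (suc n) ∎
      where
      IS = inversionSequences (suc n)
      letters′ = letters (suc (suc n))

  module Levels = Adjacent ℕ._≟_
  module Descents = Adjacent ℕ._>?_
  module Ascents = Adjacent ℕ._<?_

  sum<-levels : ∀ n m → sum< n (λ k → Levels.holds (suc k) (suc m)) ≡ (if m ℕ.<ᵇ n then 1 else 0)
  sum<-levels n m = sum<-select n m (λ _ → 1)

  sum<-ascents : ∀ n m → m ℕ.≤ n → sum< n (λ k → Ascents.holds (suc k) (suc m)) ≡ m
  sum<-ascents n       zero    _         = trans (sum<-const n 0) (ℕ.*-zeroʳ n)
  sum<-ascents (suc n) (suc m) (s≤s m≤n) = cong suc (sum<-ascents n m m≤n)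

  pairs-levels : ∀ n → Levels.pairs n ≡ n
  pairs-levels zero    = refl
  pairs-levels (suc n) = cong₂ ℕ._+_ (cong suc (trans (sum<-const (suc n) 0) (ℕ.*-zeroʳ (suc n)))) (pairs-levels n)

  -- The cells strictly above the diagonal of an n by n + 1 rectangle are half of all its cells;
  -- doubling avoids a division in ℕ.
  2*pairs-ascents : ∀ n → 2 ℕ.* Ascents.pairs n ≡ n ℕ.* suc n
  2*pairs-ascents zero    = refl
  2*pairs-ascents (suc n) = begin
    2 ℕ.* Ascents.pairs (suc n)             ≡⟨ cong (λ k → 2 ℕ.* (k ℕ.+ Ascents.pairs n)) (trans (sum<-const (suc n) 1) (ℕ.*-identityʳ (suc n))) ⟩
    2 ℕ.* (suc n ℕ.+ Ascents.pairs n)       ≡⟨ ℕ.*-distribˡ-+ 2 (suc n) (Ascents.pairs n) ⟩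
    2 ℕ.* suc n ℕ.+ 2 ℕ.* Ascents.pairs n   ≡⟨ cong (2 ℕ.* suc n ℕ.+_) (2*pairs-ascents n) ⟩
    2 ℕ.* suc n ℕ.+ n ℕ.* suc n             ≡⟨ solve 1 (λ n → con 2 :* (con 1 :+ n) :+ n :* (con 1 :+ n) := (con 1 :+ n) :* (con 2 :+ n)) refl n ⟩
    suc n ℕ.* suc (suc n)                   ∎
    where open +-*-Solver

  holds-trichotomy : ∀ a b → Levels.holds a b ℕ.+ Descents.holds a b ℕ.+ Ascents.holds a b ≡ 1
  holds-trichotomy zero    zero    = refl
  holds-trichotomy zero    (suc b) = refl
  holds-trichotomy (suc a) zero    = refl
  holds-trichotomy (suc a) (suc b) = holds-trichotomy a b

  count-trichotomy : ∀ {n} (ρ : Vec ℕ (suc n)) → levels ρ ℕ.+ descents ρ ℕ.+ ascents ρ ≡ n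
  count-trichotomy (a ∷ [])    = refl
  count-trichotomy (a ∷ b ∷ ρ) = begin
    levels (a ∷ b ∷ ρ) ℕ.+ descents (a ∷ b ∷ ρ) ℕ.+ ascents (a ∷ b ∷ ρ)
      ≡⟨ cong₂ ℕ._+_ (cong₂ ℕ._+_ (Levels.count-∷ a b ρ) (Descents.count-∷ a b ρ)) (Ascents.count-∷ a b ρ) ⟩
    (hl ℕ.+ levels (b ∷ ρ)) ℕ.+ (hd ℕ.+ descents (b ∷ ρ)) ℕ.+ (ha ℕ.+ ascents (b ∷ ρ))
      ≡⟨ solve 6 (λ p l q d r a → (p :+ l) :+ (q :+ d) :+ (r :+ a) := (p :+ q :+ r) :+ (l :+ d :+ a)) refl
           hl (levels (b ∷ ρ)) hd (descents (b ∷ ρ)) ha (ascents (b ∷ ρ)) ⟩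
    (hl ℕ.+ hd ℕ.+ ha) ℕ.+ (levels (b ∷ ρ) ℕ.+ descents (b ∷ ρ) ℕ.+ ascents (b ∷ ρ))
      ≡⟨ cong₂ ℕ._+_ (holds-trichotomy a b) (count-trichotomy (b ∷ ρ)) ⟩
    suc _ ∎
    where
    open +-*-Solver
    hl = Levels.holds a b
    hd = Descents.holds a b
    ha = Ascents.holds a b

  L+D+U : ∀ n m → m ℕ.≤ n → L (suc n) (suc m) ℕ.+ D (suc n) (suc m) ℕ.+ U (suc n) (suc m) ≡ n ! ℕ.* n
  L+D+U n m m≤n = begin
    total J levels ℕ.+ total J descents ℕ.+ total J ascents
      ≡⟨ cong (ℕ._+ total J ascents) (total-+ J levels descents) ⟨
    total J (λ ρ → levels ρ ℕ.+ descents ρ) ℕ.+ total J ascents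
      ≡⟨ total-+ J (λ ρ → levels ρ ℕ.+ descents ρ) ascents ⟨
    total J (λ ρ → levels ρ ℕ.+ descents ρ ℕ.+ ascents ρ)
      ≡⟨ total-cong J count-trichotomy ⟩
    total J (λ _ → n)
      ≡⟨ total-I n m (λ _ → n) m≤n ⟩
    total (inversionSequences n) (λ _ → n)
      ≡⟨ total-const (inversionSequences n) n ⟩
    length (inversionSequences n) ℕ.* n
      ≡⟨ cong (ℕ._* n) (length-inversionSequences n) ⟩
    n ! ℕ.* n ∎
    where J = I (suc n) (suc m)

open Counting

-- The ring of series in x and y as an iterated power series ring.

module ℚ[y] = PowerSeries ℚ.+-*-commutativeRing
module ℚ[y,x] = PowerSeries ℚ[y].commutativeRing

private
  ∑≤-∑ : ∀ n {f g} → (∀ i → f i ≡ g i) → ∑≤ n f ≡ ℚ[y].∑ n g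
  ∑≤-∑ zero    f≡g = f≡g 0
  ∑≤-∑ (suc n) f≡g = cong₂ ℚ._+_ (∑≤-∑ n f≡g) (f≡g (suc n))

  ∑≤-∑∑ : ∀ n m {f : ℕ → ℚ} {g : ℕ → ℕ → ℚ} → (∀ i → f i ≡ g i m) → ∑≤ n f ≡ ℚ[y,x].∑ n g m
  ∑≤-∑∑ zero    m f≡g = f≡g 0
  ∑≤-∑∑ (suc n) m f≡g = cong₂ ℚ._+_ (∑≤-∑∑ n m f≡g) (f≡g (suc n))

-- The product is convolution in x, with coefficients multiplied by convolution in y. Through this
-- the iterated power series ring supplies the multiplicative ring laws.
*-⊛ : ∀ f g → f * g ≈ f ℚ[y,x].⊛ g
*-⊛ f g n m = ∑≤-∑∑ n m λ i → ∑≤-∑ m λ j → refl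

0ₛ : Series
0ₛ _ _ = 0ℚ

infix 8 -_
-_ : Series → Series
(- f) n m = ℚ.- f n m

≈-refl : ∀ {f} → f ≈ f
≈-refl _ _ = refl

≈-sym : ∀ {f g} → f ≈ g → g ≈ f
≈-sym p n m = sym (p n m)

≈-trans : ∀ {f g h} → f ≈ g → g ≈ h → f ≈ h
≈-trans p q n m = trans (p n m) (q n m)

private
  module Tower = CommutativeRing ℚ[y,x].commutativeRing

  const-constant : ∀ c → const c ≈ ℚ[y,x].constant (ℚ[y].constant c)
  const-constant c zero    zero    = refl
  const-constant c zero    (suc _) = refl
  const-constant c (suc _) _       = refl

*-cong : ∀ {f f′ g g′} → f ≈ f′ → g ≈ g′ → f * g ≈ f′ * g′
*-cong {f} {f′} {g} {g′} p q =
  ≈-trans (*-⊛ f g) (≈-trans (Tower.*-cong {f} {f′} {g} {g′} p q) (≈-sym (*-⊛ f′ g′)))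

*-comm : ∀ f g → f * g ≈ g * f
*-comm f g = ≈-trans (*-⊛ f g) (≈-trans (Tower.*-comm f g) (≈-sym (*-⊛ g f)))

*-assoc : ∀ f g h → f * g * h ≈ f * (g * h)
*-assoc f g h =
  ≈-trans (*-cong {f * g} {f ℚ[y,x].⊛ g} {h} (*-⊛ f g) ≈-refl) (≈-trans (*-⊛ (f ℚ[y,x].⊛ g) h)
    (≈-trans (Tower.*-assoc f g h) (≈-sym
      (≈-trans (*-cong {f} {f} {g * h} {g ℚ[y,x].⊛ h} ≈-refl (*-⊛ g h)) (*-⊛ f (g ℚ[y,x].⊛ h))))))

*-identityˡ : ∀ f → # 1 * f ≈ f
*-identityˡ f =
  ≈-trans (*-⊛ (# 1) f) (≈-trans (Tower.*-cong {u = f} (const-constant 1ℚ) (λ _ _ → refl)) (Tower.*-identityˡ f))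

*-distribˡ-+ : ∀ f g h → f * (g + h) ≈ f * g + f * h
*-distribˡ-+ f g h = ≈-trans (*-⊛ f (g + h)) (≈-trans (Tower.distribˡ f g h)
  λ n m → cong₂ ℚ._+_ (sym (*-⊛ f g n m)) (sym (*-⊛ f h n m)))

seriesRing : CommutativeRing _ _
seriesRing = record
  { Carrier = Series
  ; _≈_     = _≈_
  ; _+_     = _+_
  ; _*_     = _*_
  ; -_      = -_
  ; 0#      = 0ₛ
  ; 1#      = # 1
  ; isCommutativeRing = record
    { isRing = record
      { +-isAbelianGroup = Tower.+-isAbelianGroup
      ; *-cong     = *-cong
      ; *-assoc    = *-assoc
      ; *-identity = *-identityˡ , λ f → ≈-trans (*-comm f (# 1)) (*-identityˡ f)
      ; distrib    = *-distribˡ-+ , λ f g h → ≈-trans (*-comm (g + h) f)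
          (≈-trans (*-distribˡ-+ f g h) λ n m → cong₂ ℚ._+_ (*-comm f g n m) (*-comm f h n m))
      }
    ; *-comm = *-comm
    }
  }

const-* : ∀ c f n m → (const c * f) n m ≡ c ℚ.* f n m
const-* c f n m = begin
  (const c * f) n m
    ≡⟨ *-cong {const c} {ℚ[y,x].constant (ℚ[y].constant c)} {f} (const-constant c) ≈-refl n m ⟩
  (ℚ[y,x].constant (ℚ[y].constant c) * f) n m
    ≡⟨ *-⊛ (ℚ[y,x].constant (ℚ[y].constant c)) f n m ⟩
  (ℚ[y,x].constant (ℚ[y].constant c) ℚ[y,x].⊛ f) n m
    ≡⟨ ℚ[y,x].constant-⊛ (ℚ[y].constant c) f n m ⟩
  (ℚ[y].constant c ℚ[y].⊛ f n) m
    ≡⟨ ℚ[y].constant-⊛ c (f n) m ⟩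
  c ℚ.* f n m ∎
  where open ≡-Reasoning

-- This lets the ring solver compute with rational coefficients, such as the ½ in the closed forms.
const-homomorphism : ℚ.+-*-rawRing -Raw-AlmostCommutative⟶ fromCommutativeRing seriesRing
const-homomorphism = record
  { ⟦_⟧    = const
  ; +-homo = λ { a b zero zero → refl ; a b zero (suc _) → refl ; a b (suc _) _ → refl }
  ; *-homo = λ a b n m → sym (trans (const-* a (const b) n m) (scaled a b n m))
  ; -‿homo = λ { a zero zero → refl ; a zero (suc _) → refl ; a (suc _) _ → refl }
  ; 0-homo = λ { zero zero → refl ; zero (suc _) → refl ; (suc _) _ → refl }
  ; 1-homo = λ _ _ → refl
  }
  where
  scaled : ∀ a b n m → a ℚ.* const b n m ≡ const (a ℚ.* b) n m
  scaled a b zero    zero    = refl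
  scaled a b zero    (suc m) = ℚ.*-zeroʳ a
  scaled a b (suc n) m       = ℚ.*-zeroʳ a

module ℚ-Solver {c ℓ} (R : CommutativeRing c ℓ)
  (ι : ℚ.+-*-rawRing -Raw-AlmostCommutative⟶ fromCommutativeRing R) where

  private
    module R = CommutativeRing R
    module ι = _-Raw-AlmostCommutative⟶_ ι

  open Algebra.Solver.Ring ℚ.+-*-rawRing (fromCommutativeRing R) ι
    (λ a b → Maybe.map (λ a≡b → R.reflexive (cong ι.⟦_⟧ a≡b)) (dec⇒maybe (a ℚ.≟ b))) public

open ℚ-Solver seriesRing const-homomorphism

module ≈-Reasoning = Relation.Binary.Reasoning.Setoid (CommutativeRing.setoid seriesRing)

+-cong : ∀ {f f′ g g′} → f ≈ f′ → g ≈ g′ → f + g ≈ f′ + g′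
+-cong p q n m = cong₂ ℚ._+_ (p n m) (q n m)

-‿cong : ∀ {f f′ g g′} → f ≈ f′ → g ≈ g′ → f - g ≈ f′ - g′
-‿cong p q n m = cong₂ ℚ._-_ (p n m) (q n m)

+-congˡ : ∀ f {g g′} → g ≈ g′ → f + g ≈ f + g′
+-congˡ f p n m = cong (f n m ℚ.+_) (p n m)

+-congʳ : ∀ g {f f′} → f ≈ f′ → f + g ≈ f′ + g
+-congʳ g p n m = cong (ℚ._+ g n m) (p n m)

*-congˡ : ∀ f {g g′} → g ≈ g′ → f * g ≈ f * g′
*-congˡ f {g} {g′} = *-cong {f} {f} {g} {g′} ≈-refl

*-congʳ : ∀ g {f f′} → f ≈ f′ → f * g ≈ f′ * g
*-congʳ g {f} {f′} p = *-cong {f} {f′} {g} {g} p ≈-refl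

private
  x-var : x ≈ ℚ[y,x].var
  x-var zero          zero    = refl
  x-var zero          (suc _) = refl
  x-var (suc zero)    zero    = refl
  x-var (suc zero)    (suc _) = refl
  x-var (suc (suc _)) zero    = refl
  x-var (suc (suc _)) (suc _) = refl

  y-var : y ≈ ℚ[y,x].constant ℚ[y].var
  y-var zero    zero          = refl
  y-var zero    (suc zero)    = refl
  y-var zero    (suc (suc _)) = refl
  y-var (suc _) _             = refl

x-*-zero : ∀ f m → (x * f) 0 m ≡ 0ℚ
x-*-zero f m = begin
  (x * f) 0 m                            ≡⟨ *-congʳ f x-var 0 m ⟩
  (ℚ[y,x].var * f) 0 m                   ≡⟨ *-⊛ ℚ[y,x].var f 0 m ⟩
  ((λ _ → 0ℚ) ℚ[y].⊛ f 0) m              ≡⟨ ℚ[y].∑-zero m (λ {i} _ → ℚ.*-zeroˡ (f 0 (m ℕ.∸ i))) ⟩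
  0ℚ                                     ∎
  where open ≡-Reasoning

x-*-suc : ∀ f n m → (x * f) (suc n) m ≡ f n m
x-*-suc f n m = begin
  (x * f) (suc n) m                      ≡⟨ *-congʳ f x-var (suc n) m ⟩
  (ℚ[y,x].var * f) (suc n) m             ≡⟨ *-⊛ ℚ[y,x].var f (suc n) m ⟩
  (ℚ[y,x].var ℚ[y,x].⊛ f) (suc n) m      ≡⟨ ℚ[y,x].var-⊛-suc f n m ⟩
  f n m                                  ∎
  where open ≡-Reasoning

private
  y-*-row : ∀ f n m → (y * f) n m ≡ (ℚ[y].var ℚ[y].⊛ f n) m
  y-*-row f n m = begin
    (y * f) n m                                     ≡⟨ *-congʳ f y-var n m ⟩
    (ℚ[y,x].constant ℚ[y].var * f) n m              ≡⟨ *-⊛ (ℚ[y,x].constant ℚ[y].var) f n m ⟩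
    (ℚ[y,x].constant ℚ[y].var ℚ[y,x].⊛ f) n m       ≡⟨ ℚ[y,x].constant-⊛ ℚ[y].var f n m ⟩
    (ℚ[y].var ℚ[y].⊛ f n) m                         ∎
    where open ≡-Reasoning

y-*-zero : ∀ f n → (y * f) n 0 ≡ 0ℚ
y-*-zero f n = trans (y-*-row f n 0) (ℚ.*-zeroˡ (f n 0))

y-*-suc : ∀ f n m → (y * f) n (suc m) ≡ f n m
y-*-suc f n m = trans (y-*-row f n (suc m)) (ℚ[y].var-⊛-suc (f n) m)

-- Natural numbers in ℚ and the Euler operator.

ι : ℕ → ℚ
ι n = + n ℚ./ 1

/-as-ℚᵘ : ∀ z d .{{_ : ℕ.NonZero d}} → ℚ.toℚᵘ (z ℚ./ d) ℚᵘ.≃ (z ℚᵘ./ d)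
/-as-ℚᵘ z (suc d) = ℚ.toℚᵘ-fromℚᵘ (ℚᵘ.mkℚᵘ z d)

ι-+ : ∀ m n → ι (m ℕ.+ n) ≡ ι m ℚ.+ ι n
ι-+ m n = ℚ.toℚᵘ-injective (begin
  ℚ.toℚᵘ (ι (m ℕ.+ n))              ≈⟨ /-as-ℚᵘ (+ (m ℕ.+ n)) 1 ⟩
  + (m ℕ.+ n) ℚᵘ./ 1                ≈⟨ ℚᵘ.*≡* (cong (ℤ._* + 1) (sym (cong₂ ℤ._+_ (ℤ.*-identityʳ (+ m)) (ℤ.*-identityʳ (+ n))))) ⟩
  (+ m ℚᵘ./ 1) ℚᵘ.+ (+ n ℚᵘ./ 1)    ≈⟨ ℚᵘ.+-cong (/-as-ℚᵘ (+ m) 1) (/-as-ℚᵘ (+ n) 1) ⟨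
  ℚ.toℚᵘ (ι m) ℚᵘ.+ ℚ.toℚᵘ (ι n)    ≈⟨ ℚ.toℚᵘ-homo-+ (ι m) (ι n) ⟨
  ℚ.toℚᵘ (ι m ℚ.+ ι n)              ∎)
  where open Relation.Binary.Reasoning.Setoid ℚᵘ.≃-setoid

/-cancel : ∀ z d .{{_ : ℕ.NonZero d}} → (z ℚ./ d) ℚ.* ι d ≡ z ℚ./ 1
/-cancel z d@(suc _) = ℚ.toℚᵘ-injective (begin
  ℚ.toℚᵘ ((z ℚ./ d) ℚ.* ι d)              ≈⟨ ℚ.toℚᵘ-homo-* (z ℚ./ d) (ι d) ⟩
  ℚ.toℚᵘ (z ℚ./ d) ℚᵘ.* ℚ.toℚᵘ (ι d)      ≈⟨ ℚᵘ.*-cong (/-as-ℚᵘ z d) (/-as-ℚᵘ (+ d) 1) ⟩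
  (z ℚᵘ./ d) ℚᵘ.* (+ d ℚᵘ./ 1)            ≈⟨ ℚᵘ.*≡* (trans (ℤ.*-identityʳ (z ℤ.* + d)) (cong (λ k → z ℤ.* + k) (sym (ℕ.*-identityʳ d)))) ⟩
  z ℚᵘ./ 1                                ≈⟨ /-as-ℚᵘ z 1 ⟨
  ℚ.toℚᵘ (z ℚ./ 1)                        ∎)
  where open Relation.Binary.Reasoning.Setoid ℚᵘ.≃-setoid

-‿/1 : ∀ z → (-1ℤ ℤ.* z) ℚ./ 1 ≡ ℚ.- (z ℚ./ 1)
-‿/1 z = ℚ.toℚᵘ-injective (begin
  ℚ.toℚᵘ ((-1ℤ ℤ.* z) ℚ./ 1)      ≈⟨ /-as-ℚᵘ (-1ℤ ℤ.* z) 1 ⟩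
  (-1ℤ ℤ.* z) ℚᵘ./ 1              ≈⟨ ℚᵘ.*≡* (cong (ℤ._* + 1) (ℤ.-1*i≡-i z)) ⟩
  ℚᵘ.- (z ℚᵘ./ 1)                 ≈⟨ ℚᵘ.-‿cong (/-as-ℚᵘ z 1) ⟨
  ℚᵘ.- ℚ.toℚᵘ (z ℚ./ 1)           ≈⟨ ℚ.toℚᵘ-homo‿- (z ℚ./ 1) ⟨
  ℚ.toℚᵘ (ℚ.- (z ℚ./ 1))          ∎)
  where open Relation.Binary.Reasoning.Setoid ℚᵘ.≃-setoid

-- The Euler operator x ∂/∂x.
θ : Series → Series
θ f n m = ι n ℚ.* f n m

private
  weights : ℕ → ℕ → ℚ
  weights n = ℚ[y].constant (ι n)

  weights-+ : ∀ i j → weights (i ℕ.+ j) ℚ[y].≋ weights i ℚ[y].⊕ weights j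
  weights-+ i j zero    = ι-+ i j
  weights-+ i j (suc _) = refl

  θ-weight : ∀ f → ℚ[y,x].weight weights weights-+ f ≈ θ f
  θ-weight f n m = ℚ[y].constant-⊛ (ι n) (f n) m

θ-cong : ∀ {f g} → f ≈ g → θ f ≈ θ g
θ-cong p n m = cong (ι n ℚ.*_) (p n m)

θ-+ : ∀ f g → θ (f + g) ≈ θ f + θ g
θ-+ f g n m = ℚ.*-distribˡ-+ (ι n) _ _

θ-‿- : ∀ f g → θ (f - g) ≈ θ f - θ g
θ-‿- f g n m = trans (ℚ.*-distribˡ-+ (ι n) _ _)
  (cong (ι n ℚ.* f n m ℚ.+_) (sym (ℚ.neg-distribʳ-* (ι n) (g n m))))

θ-* : ∀ f g → θ (f * g) ≈ θ f * g + f * θ g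
θ-* f g = begin
  θ (f * g)                            ≈⟨ θ-cong (*-⊛ f g) ⟩
  θ (f ℚ[y,x].⊛ g)                     ≈⟨ θ-weight (f ℚ[y,x].⊛ g) ⟨
  ℚ[y,x].weight weights weights-+ (f ℚ[y,x].⊛ g)   ≈⟨ ℚ[y,x].weight-⊛ weights weights-+ f g ⟩
  (W f ℚ[y,x].⊛ g) + (f ℚ[y,x].⊛ W g)  ≈⟨ +-cong (*-⊛ (W f) g) (*-⊛ f (W g)) ⟨
  W f * g + f * W g                    ≈⟨ +-cong (*-congʳ g (θ-weight f)) (*-congˡ f (θ-weight g)) ⟩
  θ f * g + f * θ g                    ∎
  where
  open ≈-Reasoning
  W = ℚ[y,x].weight weights weights-+

-- `θ` multiplies row n by n, so it forgets row 0 alone, and every other row is recovered by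
-- dividing by n. This is the uniqueness principle behind logarithms and integrals.
θ-injective : ∀ {f g} → (∀ m → f 0 m ≡ g 0 m) → θ f ≈ θ g → f ≈ g
θ-injective                f₀≡g₀ θf≈θg zero      m = f₀≡g₀ m
θ-injective {f} {g} f₀≡g₀ θf≈θg n@(suc _) m = begin
  f n m                                     ≡⟨ unit (f n m) ⟨
  (+ 1 ℚ./ n) ℚ.* (ι n ℚ.* f n m)           ≡⟨ cong ((+ 1 ℚ./ n) ℚ.*_) (θf≈θg n m) ⟩
  (+ 1 ℚ./ n) ℚ.* (ι n ℚ.* g n m)           ≡⟨ unit (g n m) ⟩
  g n m                                     ∎
  where
  open ≡-Reasoning
  unit : ∀ q → (+ 1 ℚ./ n) ℚ.* (ι n ℚ.* q) ≡ q
  unit q = trans (sym (ℚ.*-assoc (+ 1 ℚ./ n) (ι n) q))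
    (trans (cong (ℚ._* q) (/-cancel (+ 1) n)) (ℚ.*-identityˡ q))

-- Composition, inverses and logarithms of series

private
  ∑≤-cong : ∀ n {f g} → (∀ {i} → i ℕ.≤ n → f i ≡ g i) → ∑≤ n f ≡ ∑≤ n g
  ∑≤-cong zero    p = p z≤n
  ∑≤-cong (suc n) p = cong₂ ℚ._+_ (∑≤-cong n λ i≤n → p (ℕ.m≤n⇒m≤1+n i≤n)) (p ℕ.≤-refl)

  ∑≤-zero : ∀ n {f} → (∀ {i} → i ℕ.≤ n → f i ≡ 0ℚ) → ∑≤ n f ≡ 0ℚ
  ∑≤-zero zero    p = p z≤n
  ∑≤-zero (suc n) p = cong₂ ℚ._+_ (∑≤-zero n λ i≤n → p (ℕ.m≤n⇒m≤1+n i≤n)) (p ℕ.≤-refl)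

-- A coefficient of a product sees only coefficients of no larger degree in either variable; this
-- permits replacing a composition by one of its partial sums.
*-local : ∀ f {g g′} n m → (∀ {i j} → i ℕ.≤ n → j ℕ.≤ m → g i j ≡ g′ i j) →
          (f * g) n m ≡ (f * g′) n m
*-local f n m p = ∑≤-cong n λ {i} _ → ∑≤-cong m λ {j} _ →
  cong (f i j ℚ.*_) (p (ℕ.m∸n≤m n i) (ℕ.m∸n≤m m j))

VanishesBelow : ℕ → Series → Set
VanishesBelow k f = ∀ n m → n ℕ.+ m ℕ.< k → f n m ≡ 0ℚ

-- The term with i = j = 0 dies because h has no constant term; in every other term the coefficient
-- of g has total degree below k.
vanishes-* : ∀ {h g k} → h 0 0 ≡ 0ℚ → VanishesBelow k g → VanishesBelow (suc k) (h * g)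
vanishes-* {h} {g} {k} h₀≡0 vg n m (s≤s n+m≤k) =
  ∑≤-zero n λ {i} i≤n → ∑≤-zero m λ {j} j≤m → term i j i≤n j≤m
  where
  smaller : ∀ i j → i ℕ.≤ n → j ℕ.≤ m → 0 ℕ.< i ℕ.+ j → (n ℕ.∸ i) ℕ.+ (m ℕ.∸ j) ℕ.< k
  smaller i j i≤n j≤m 0<i+j = begin-strict
    (n ℕ.∸ i) ℕ.+ (m ℕ.∸ j)                       <⟨ ℕ.m<n+m _ 0<i+j ⟩
    (i ℕ.+ j) ℕ.+ ((n ℕ.∸ i) ℕ.+ (m ℕ.∸ j))       ≡⟨ +-interchange i j _ _ ⟩
    (i ℕ.+ (n ℕ.∸ i)) ℕ.+ (j ℕ.+ (m ℕ.∸ j))       ≡⟨ cong₂ ℕ._+_ (ℕ.m+[n∸m]≡n i≤n) (ℕ.m+[n∸m]≡n j≤m) ⟩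
    n ℕ.+ m                                       ≤⟨ n+m≤k ⟩
    k                                             ∎
    where
    open ℕ.≤-Reasoning
    open import Algebra.Properties.CommutativeSemigroup ℕ.+-commutativeSemigroup
      using () renaming (interchange to +-interchange)

  term : ∀ i j → i ℕ.≤ n → j ℕ.≤ m → h i j ℚ.* g (n ℕ.∸ i) (m ℕ.∸ j) ≡ 0ℚ
  right : ∀ i j → i ℕ.≤ n → j ℕ.≤ m → 0 ℕ.< i ℕ.+ j → h i j ℚ.* g (n ℕ.∸ i) (m ℕ.∸ j) ≡ 0ℚ
  right i j i≤n j≤m 0<i+j = trans
    (cong (h i j ℚ.*_) (vg (n ℕ.∸ i) (m ℕ.∸ j) (smaller i j i≤n j≤m 0<i+j))) (ℚ.*-zeroʳ (h i j))
  term zero    zero    i≤n j≤m = trans (cong (ℚ._* g n m) h₀≡0) (ℚ.*-zeroˡ (g n m))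
  term zero    (suc j) i≤n j≤m = right zero (suc j) i≤n j≤m (s≤s z≤n)
  term (suc i) j       i≤n j≤m = right (suc i) j i≤n j≤m (s≤s z≤n)

vanishes-^ : ∀ h → h 0 0 ≡ 0ℚ → ∀ k → VanishesBelow k (h ^ k)
vanishes-^ h h₀≡0 zero    n m ()
vanishes-^ h h₀≡0 (suc k) = vanishes-* {h} {h ^ k} h₀≡0 (vanishes-^ h h₀≡0 k)

vanishes-*ʳ : ∀ {f k} g → VanishesBelow k f → VanishesBelow k (g * f)
vanishes-*ʳ {f} {k} g vf n m n+m<k = trans
  (*-local g {f} {0ₛ} n m λ i≤n j≤m → vf _ _ (ℕ.≤-<-trans (ℕ.+-mono-≤ i≤n j≤m) n+m<k))
  (∑≤-zero n λ {i} _ → ∑≤-zero m λ {j} _ → ℚ.*-zeroʳ (g i j))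

-- The cutoff of `compose` moves with the coefficient. Here it is fixed, so that the sum is a
-- polynomial in h to which ring identities apply.
partial : (ℕ → ℚ) → Series → ℕ → Series
partial a h N n m = ∑≤ N λ k → a k ℚ.* (h ^ k) n m

partial-suc : ∀ a h N → partial a h (suc N) ≈ partial a h N + const (a (suc N)) * h ^ suc N
partial-suc a h N n m =
  cong (partial a h N n m ℚ.+_) (sym (const-* (a (suc N)) (h ^ suc N) n m))

-- Powers beyond n + m contribute nothing to the coefficient of total degree n + m, so any larger
-- cutoff gives the same value.
partial-compose : ∀ a h → h 0 0 ≡ 0ℚ → ∀ {n m N} → n ℕ.+ m ℕ.≤ N →
                  partial a h N n m ≡ compose a h n m
partial-compose a h h₀≡0 {n} {m} n+m≤N = go (ℕ.≤⇒≤′ n+m≤N)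
  where
  go : ∀ {N} → n ℕ.+ m ℕ.≤′ N → partial a h N n m ≡ compose a h n m
  go ℕ.≤′-refl                = refl
  go (ℕ.≤′-step {N} n+m≤′N) = begin
    partial a h N n m ℚ.+ a (suc N) ℚ.* (h ^ suc N) n m
      ≡⟨ cong₂ (λ p q → p ℚ.+ a (suc N) ℚ.* q) (go n+m≤′N)
           (vanishes-^ h h₀≡0 (suc N) n m (s≤s (ℕ.≤′⇒≤ n+m≤′N))) ⟩
    compose a h n m ℚ.+ a (suc N) ℚ.* 0ℚ
      ≡⟨ cong (compose a h n m ℚ.+_) (ℚ.*-zeroʳ (a (suc N))) ⟩
    compose a h n m ℚ.+ 0ℚ
      ≡⟨ ℚ.+-identityʳ _ ⟩
    compose a h n m ∎
    where open ≡-Reasoning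

geometric-partial : ∀ h N → (# 1 - h) * partial (λ _ → 1ℚ) h N + h ^ suc N ≈ # 1
geometric-partial h zero = begin
  (# 1 - h) * partial (λ _ → 1ℚ) h 0 + h * # 1
    ≈⟨ +-congʳ (h * # 1) (*-congˡ (# 1 - h) {partial (λ _ → 1ℚ) h 0} {# 1} (λ n m → ℚ.*-identityˡ ((# 1) n m))) ⟩
  (# 1 - h) * # 1 + h * # 1
    ≈⟨ solve 1 (λ h → (con 1ℚ :- h) :* con 1ℚ :+ h :* con 1ℚ := con 1ℚ) (λ _ _ → refl) h ⟩
  # 1 ∎
  where open ≈-Reasoning
geometric-partial h (suc N) = begin
  (# 1 - h) * partial (λ _ → 1ℚ) h (suc N) + h * h ^ suc N
    ≈⟨ +-congʳ (h * h ^ suc N) (*-congˡ (# 1 - h) (partial-suc (λ _ → 1ℚ) h N)) ⟩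
  (# 1 - h) * (partial (λ _ → 1ℚ) h N + # 1 * h ^ suc N) + h * h ^ suc N
    ≈⟨ solve 3 (λ h p q → (con 1ℚ :- h) :* (p :+ con 1ℚ :* q) :+ h :* q := (con 1ℚ :- h) :* p :+ q)
         (λ _ _ → refl) h (partial (λ _ → 1ℚ) h N) (h ^ suc N) ⟩
  (# 1 - h) * partial (λ _ → 1ℚ) h N + h ^ suc N
    ≈⟨ geometric-partial h N ⟩
  # 1 ∎
  where open ≈-Reasoning

-- At a coefficient of total degree n + m the cutoff n + m is enough: the remainder h ^ suc (n + m)
-- of the finite geometric sum vanishes there.
geometric-compose : ∀ h → h 0 0 ≡ 0ℚ → (# 1 - h) * compose (λ _ → 1ℚ) h ≈ # 1
geometric-compose h h₀≡0 n m = begin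
  ((# 1 - h) * compose (λ _ → 1ℚ) h) n m
    ≡⟨ *-local (# 1 - h) n m (λ {i} {j} i≤n j≤m → sym (partial-compose (λ _ → 1ℚ) h h₀≡0 {i} {j} {n ℕ.+ m} (ℕ.+-mono-≤ i≤n j≤m))) ⟩
  ((# 1 - h) * partial (λ _ → 1ℚ) h (n ℕ.+ m)) n m
    ≡⟨ ℚ.+-identityʳ _ ⟨
  ((# 1 - h) * partial (λ _ → 1ℚ) h (n ℕ.+ m)) n m ℚ.+ 0ℚ
    ≡⟨ cong (((# 1 - h) * partial (λ _ → 1ℚ) h (n ℕ.+ m)) n m ℚ.+_)
         (vanishes-^ h h₀≡0 (suc (n ℕ.+ m)) n m ℕ.≤-refl) ⟨
  ((# 1 - h) * partial (λ _ → 1ℚ) h (n ℕ.+ m)) n m ℚ.+ (h ^ suc (n ℕ.+ m)) n m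
    ≡⟨ geometric-partial h (n ℕ.+ m) n m ⟩
  (# 1) n m ∎
  where open ≡-Reasoning

inverse-* : ∀ g .{{_ : ℚ.NonZero (g 0 0)}} → inverse g * g ≈ # 1
inverse-* g = begin
  const c⁻¹ * s * g
    ≈⟨ solve 3 (λ c s g → c :* s :* g := (con 1ℚ :- (con 1ℚ :- c :* g)) :* s) (λ _ _ → refl) (const c⁻¹) s g ⟩
  (# 1 - h) * s
    ≈⟨ geometric-compose h h₀≡0 ⟩
  # 1 ∎
  where
  open ≈-Reasoning
  c⁻¹ = ℚ.1/ (g 0 0)
  h = # 1 - const c⁻¹ * g
  s = compose (λ _ → 1ℚ) h
  h₀≡0 : h 0 0 ≡ 0ℚ
  h₀≡0 = cong (λ q → 1ℚ ℚ.- q) (ℚ.*-inverseˡ (g 0 0))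

-- This is how denominators are cleared: a series with nonzero constant term is a unit, so an
-- identity may be proved after multiplying by it.
cancelˡ : ∀ g .{{_ : ℚ.NonZero (g 0 0)}} {f f′} → g * f ≈ g * f′ → f ≈ f′
cancelˡ g {f} {f′} gf≈gf′ = begin
  f                    ≈⟨ unit f ⟨
  inverse g * (g * f)  ≈⟨ *-congˡ (inverse g) gf≈gf′ ⟩
  inverse g * (g * f′) ≈⟨ unit f′ ⟩
  f′                   ∎
  where
  open ≈-Reasoning
  unit : ∀ f → inverse g * (g * f) ≈ f
  unit f = begin
    inverse g * (g * f)  ≈⟨ *-assoc (inverse g) g f ⟨
    inverse g * g * f    ≈⟨ *-congʳ f (inverse-* g) ⟩
    # 1 * f              ≈⟨ *-identityˡ f ⟩
    f                    ∎

θ-const : ∀ c f → θ (const c * f) ≈ const c * θ f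
θ-const c f n m = begin
  ι n ℚ.* (const c * f) n m   ≡⟨ cong (ι n ℚ.*_) (const-* c f n m) ⟩
  ι n ℚ.* (c ℚ.* f n m)       ≡⟨ x∙yz≈y∙xz (ι n) c (f n m) ⟩
  c ℚ.* (ι n ℚ.* f n m)       ≡⟨ const-* c (θ f) n m ⟨
  (const c * θ f) n m         ∎
  where
  open ≡-Reasoning
  open import Algebra.Properties.CommutativeSemigroup (CommutativeRing.*-commutativeSemigroup ℚ.+-*-commutativeRing)
    using (x∙yz≈y∙xz)

0ₛ-const : 0ₛ ≈ const 0ℚ
0ₛ-const zero    zero    = refl
0ₛ-const zero    (suc _) = refl
0ₛ-const (suc _) _       = refl

θ-1 : θ (# 1) ≈ 0ₛ
θ-1 zero    m       = ℚ.*-zeroˡ ((# 1) 0 m)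
θ-1 (suc n) m       = ℚ.*-zeroʳ (ι (suc n))

const-ι-suc : ∀ k → const (ι (suc k)) ≈ # 1 + const (ι k)
const-ι-suc k zero    zero    = ι-+ 1 k
const-ι-suc k zero    (suc _) = refl
const-ι-suc k (suc _) _       = refl

θ-^ : ∀ h k → θ (h ^ suc k) ≈ const (ι (suc k)) * (h ^ k * θ h)
θ-^ h zero = begin
  θ (h * # 1)                  ≈⟨ θ-* h (# 1) ⟩
  θ h * # 1 + h * θ (# 1)      ≈⟨ +-congˡ (θ h * # 1) (*-congˡ h θ-1) ⟩
  θ h * # 1 + h * 0ₛ           ≈⟨ +-congˡ (θ h * # 1) (*-congˡ h 0ₛ-const) ⟩
  θ h * # 1 + h * const 0ℚ     ≈⟨ solve 2 (λ h t → t :* con 1ℚ :+ h :* con 0ℚ := con 1ℚ :* (con 1ℚ :* t)) (λ _ _ → refl) h (θ h) ⟩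
  # 1 * (# 1 * θ h)            ∎
  where open ≈-Reasoning
θ-^ h (suc k) = begin
  θ (h * h ^ suc k)
    ≈⟨ θ-* h (h ^ suc k) ⟩
  θ h * h ^ suc k + h * θ (h ^ suc k)
    ≈⟨ +-congˡ (θ h * h ^ suc k) (*-congˡ h (θ-^ h k)) ⟩
  θ h * h ^ suc k + h * (const (ι (suc k)) * (h ^ k * θ h))
    ≈⟨ solve 4 (λ h t p c → t :* (h :* p) :+ h :* (c :* (p :* t)) := (con 1ℚ :+ c) :* (h :* p :* t))
         (λ _ _ → refl) h (θ h) (h ^ k) (const (ι (suc k))) ⟩
  (# 1 + const (ι (suc k))) * (h ^ suc k * θ h)
    ≈⟨ *-congʳ (h ^ suc k * θ h) (const-ι-suc (suc k)) ⟨
  const (ι (suc (suc k))) * (h ^ suc k * θ h) ∎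
  where open ≈-Reasoning

-- The coefficients of 1/(1 + h): differentiating h ^ suc k / suc k cancels the denominator and
-- leaves only the sign.
sign : ℕ → ℚ
sign k = (-1ℤ ℤ.^ k) ℚ./ 1

const-sign-suc : ∀ k → const (sign (suc k)) ≈ 0ₛ - const (sign k)
const-sign-suc k zero    zero    = trans (-‿/1 (-1ℤ ℤ.^ k)) (sym (ℚ.+-identityˡ _))
const-sign-suc k zero    (suc _) = refl
const-sign-suc k (suc _) _       = refl

private
  ln-step : ∀ h k → θ (const (lnCoefficient (suc k)) * h ^ suc k) ≈ const (sign k) * (h ^ k * θ h)
  ln-step h k n m = begin
    θ (const c * h ^ suc k) n m                    ≡⟨ θ-const c (h ^ suc k) n m ⟩
    (const c * θ (h ^ suc k)) n m                  ≡⟨ const-* c (θ (h ^ suc k)) n m ⟩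
    c ℚ.* θ (h ^ suc k) n m                        ≡⟨ cong (c ℚ.*_) (trans (θ-^ h k n m) (const-* (ι (suc k)) (h ^ k * θ h) n m)) ⟩
    c ℚ.* (ι (suc k) ℚ.* (h ^ k * θ h) n m)        ≡⟨ ℚ.*-assoc c (ι (suc k)) _ ⟨
    c ℚ.* ι (suc k) ℚ.* (h ^ k * θ h) n m          ≡⟨ cong (ℚ._* (h ^ k * θ h) n m) (/-cancel (-1ℤ ℤ.^ k) (suc k)) ⟩
    sign k ℚ.* (h ^ k * θ h) n m                   ≡⟨ const-* (sign k) (h ^ k * θ h) n m ⟨
    (const (sign k) * (h ^ k * θ h)) n m           ∎
    where
    open ≡-Reasoning
    c = lnCoefficient (suc k)

private
  -- Under `θ` the partial logarithm becomes θ h times an alternating geometric sum, which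
  -- telescopes against 1 + h and leaves one remainder term.
  ln-partial : ∀ h N → (# 1 + h) * θ (partial lnCoefficient h N) + const (sign N) * (h ^ N * θ h) ≈ θ h
  ln-partial h zero = begin
    (# 1 + h) * θ (partial lnCoefficient h 0) + # 1 * (# 1 * θ h)
      ≈⟨ +-congʳ (# 1 * (# 1 * θ h)) (*-congˡ (# 1 + h) θ-partial₀) ⟩
    (# 1 + h) * const 0ℚ + # 1 * (# 1 * θ h)
      ≈⟨ solve 2 (λ h t → (con 1ℚ :+ h) :* con 0ℚ :+ con 1ℚ :* (con 1ℚ :* t) := t) (λ _ _ → refl) h (θ h) ⟩
    θ h ∎
    where
    open ≈-Reasoning
    θ-partial₀ : θ (partial lnCoefficient h 0) ≈ const 0ℚ
    θ-partial₀ n m = trans (cong (ι n ℚ.*_) (ℚ.*-zeroˡ ((# 1) n m)))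
      (trans (ℚ.*-zeroʳ (ι n)) (0ₛ-const n m))
  ln-partial h (suc N) = begin
    (# 1 + h) * θ (partial lnCoefficient h (suc N)) + const (sign (suc N)) * (h * h ^ N * θ h)
      ≈⟨ +-cong {f′ = (# 1 + h) * (θ P + s * (h ^ N * θ h))} (*-congˡ (# 1 + h) θ-partial)
           (*-congʳ (h * h ^ N * θ h) (const-sign-suc N)) ⟩
    (# 1 + h) * (θ P + s * (h ^ N * θ h)) + (0ₛ - s) * (h * h ^ N * θ h)
      ≈⟨ +-congˡ ((# 1 + h) * (θ P + s * (h ^ N * θ h))) (*-congʳ (h * h ^ N * θ h) (-‿cong {0ₛ} {const 0ℚ} {s} {s} 0ₛ-const ≈-refl)) ⟩
    (# 1 + h) * (θ P + s * (h ^ N * θ h)) + (const 0ℚ - s) * (h * h ^ N * θ h)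
      ≈⟨ solve 5 (λ h p s k t → (con 1ℚ :+ h) :* (p :+ s :* (k :* t)) :+ (con 0ℚ :- s) :* (h :* k :* t)
                              := (con 1ℚ :+ h) :* p :+ s :* (k :* t))
           (λ _ _ → refl) h (θ P) s (h ^ N) (θ h) ⟩
    (# 1 + h) * θ P + s * (h ^ N * θ h)
      ≈⟨ ln-partial h N ⟩
    θ h ∎
    where
    open ≈-Reasoning
    P = partial lnCoefficient h N
    s = const (sign N)
    t = const (lnCoefficient (suc N)) * h ^ suc N
    θ-partial : θ (partial lnCoefficient h (suc N)) ≈ θ P + s * (h ^ N * θ h)
    θ-partial = begin
      θ (partial lnCoefficient h (suc N))  ≈⟨ θ-cong (partial-suc lnCoefficient h N) ⟩
      θ (P + t)                            ≈⟨ θ-+ P t ⟩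
      θ P + θ t                            ≈⟨ +-congˡ (θ P) (ln-step h N) ⟩
      θ P + s * (h ^ N * θ h)              ∎

  ln-compose : ∀ h → h 0 0 ≡ 0ℚ → (# 1 + h) * θ (compose lnCoefficient h) ≈ θ h
  ln-compose h h₀≡0 n m = begin
    ((# 1 + h) * θ (compose lnCoefficient h)) n m
      ≡⟨ *-local (# 1 + h) n m (λ {i} {j} i≤n j≤m → cong (ι i ℚ.*_)
           (sym (partial-compose lnCoefficient h h₀≡0 {i} {j} {N} (ℕ.m≤n⇒m≤1+n (ℕ.+-mono-≤ i≤n j≤m))))) ⟩
    ((# 1 + h) * θ (partial lnCoefficient h N)) n m
      ≡⟨ ℚ.+-identityʳ _ ⟨
    ((# 1 + h) * θ (partial lnCoefficient h N)) n m ℚ.+ 0ℚ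
      ≡⟨ cong (((# 1 + h) * θ (partial lnCoefficient h N)) n m ℚ.+_) tail≡0 ⟨
    ((# 1 + h) * θ (partial lnCoefficient h N)) n m ℚ.+ (const (sign N) * (h ^ N * θ h)) n m
      ≡⟨ ln-partial h N n m ⟩
    θ h n m ∎
    where
    open ≡-Reasoning
    -- One more than for the geometric series: the remainder carries h ^ N instead of h ^ suc N, and
    -- it has to vanish in total degree n + m.
    N = suc (n ℕ.+ m)
    tail≡0 : (const (sign N) * (h ^ N * θ h)) n m ≡ 0ℚ
    tail≡0 = trans (*-congˡ (const (sign N)) (*-comm (h ^ N) (θ h)) n m)
      (vanishes-*ʳ {θ h * h ^ N} (const (sign N))
        (vanishes-*ʳ {h ^ N} (θ h) (vanishes-^ h h₀≡0 N)) n m ℕ.≤-refl)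

ln-θ : ∀ f {f₀≡1} → f * θ (ln f {f₀≡1}) ≈ θ f
ln-θ f {f₀≡1} = begin
  f * θ (ln f {f₀≡1})
    ≈⟨ *-congʳ (θ (ln f {f₀≡1})) (solve 1 (λ f → f := con 1ℚ :+ (f :- con 1ℚ)) (λ _ _ → refl) f) ⟩
  (# 1 + h) * θ (ln f {f₀≡1})
    ≈⟨ ln-compose h (cong (ℚ._- 1ℚ) (toWitness f₀≡1)) ⟩
  θ h
    ≈⟨ θ-+ f (- # 1) ⟩
  θ f + θ (- # 1)
    ≈⟨ +-congˡ (θ f) θ-‿1 ⟩
  θ f + const 0ℚ
    ≈⟨ solve 1 (λ f → f :+ con 0ℚ := f) (λ _ _ → refl) (θ f) ⟩
  θ f ∎
  where
  open ≈-Reasoning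
  h = f - # 1
  θ-‿1 : θ (- # 1) ≈ const 0ℚ
  θ-‿1 zero    zero    = refl
  θ-‿1 zero    (suc m) = refl
  θ-‿1 (suc n) m       = ℚ.*-zeroʳ (ι (suc n))

-- Since the whole row 0 of f - 1 is zero, every positive power of it has zero row 0, and the
-- logarithm has no term for k = 0.
ln-row₀ : ∀ f {f₀≡1} → (∀ m → f 0 m ≡ (# 1) 0 m) → ∀ m → ln f {f₀≡1} 0 m ≡ 0ℚ
ln-row₀ f f₀≡ m = ∑≤-zero m λ {k} _ → term k
  where
  h = f - # 1
  h₀≡0 : ∀ j → h 0 j ≡ 0ℚ
  h₀≡0 j = trans (cong (ℚ._- (# 1) 0 j) (f₀≡ j)) (ℚ.+-inverseʳ ((# 1) 0 j))
  term : ∀ k → lnCoefficient k ℚ.* (h ^ k) 0 m ≡ 0ℚ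
  term zero    = ℚ.*-zeroˡ ((# 1) 0 m)
  term (suc k) = trans (cong (lnCoefficient (suc k) ℚ.*_) (∑≤-zero m λ {j} _ →
      trans (cong (ℚ._* (h ^ k) 0 (m ℕ.∸ j)) (h₀≡0 j)) (ℚ.*-zeroˡ ((h ^ k) 0 (m ℕ.∸ j)))))
    (ℚ.*-zeroʳ (lnCoefficient (suc k)))

ln-unique : ∀ f {f₀≡1} ℓ → (∀ m → f 0 m ≡ (# 1) 0 m) → (∀ m → ℓ 0 m ≡ 0ℚ) → f * θ ℓ ≈ θ f →
            ln f {f₀≡1} ≈ ℓ
ln-unique f {f₀≡1} ℓ f-row₀ ℓ-row₀ fθℓ≈θf = θ-injective
  (λ m → trans (ln-row₀ f {f₀≡1} f-row₀ m) (sym (ℓ-row₀ m)))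
  (cancelˡ f {{≡.subst ℚ.NonZero (sym (f-row₀ 0)) ℕ.nonZero}} {θ (ln f {f₀≡1})} {θ ℓ}
    (≈-trans (ln-θ f {f₀≡1}) (≈-sym fθℓ≈θf)))

-- The substitution of xy for x.

open import Algebra.Properties.Semiring.Exp (CommutativeRing.semiring ℚ[y].commutativeRing)
  using () renaming (_^_ to _^′_)

-- The substitution x ↦ xy.
σ : Series → Series
σ = ℚ[y,x].scale ℚ[y].var

-- Multiplication of a series in y by yⁿ, in a form that computes. The product rule for `σ` comes
-- from `scale`, its coefficients from here.
shift : ℕ → (ℕ → ℚ) → ℕ → ℚ
shift zero    s m       = s m
shift (suc n) s zero    = 0ℚ
shift (suc n) s (suc m) = shift n s m

σ-shift : ∀ f n m → σ f n m ≡ shift n (f n) m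
σ-shift f n m = go n (f n) m
  where
  go : ∀ n s m → (ℚ[y].var ^′ n ℚ[y].⊛ s) m ≡ shift n s m
  go zero    s m       = ℚ[y].⊛-identityˡ s m
  go (suc n) s zero    = trans (ℚ[y].⊛-assoc ℚ[y].var (ℚ[y].var ^′ n) s 0)
    (ℚ.*-zeroˡ ((ℚ[y].var ^′ n ℚ[y].⊛ s) 0))
  go (suc n) s (suc m) = trans (ℚ[y].⊛-assoc ℚ[y].var (ℚ[y].var ^′ n) s (suc m))
    (trans (ℚ[y].var-⊛-suc (ℚ[y].var ^′ n ℚ[y].⊛ s) m) (go n s m))

shift-cong : ∀ n {s t} → (∀ m → s m ≡ t m) → ∀ m → shift n s m ≡ shift n t m
shift-cong zero    p m       = p m
shift-cong (suc n) p zero    = refl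
shift-cong (suc n) p (suc m) = shift-cong n p m

σ-cong : ∀ {f g} → f ≈ g → σ f ≈ σ g
σ-cong {f} {g} p n m = trans (σ-shift f n m) (trans (shift-cong n (p n) m) (sym (σ-shift g n m)))

σ-* : ∀ f g → σ (f * g) ≈ σ f * σ g
σ-* f g = ≈-trans (σ-cong (*-⊛ f g))
  (≈-trans (ℚ[y,x].scale-⊛ ℚ[y].var f g) (≈-sym (*-⊛ (σ f) (σ g))))

σ-+ : ∀ f g → σ (f + g) ≈ σ f + σ g
σ-+ f g n m = ℚ[y].⊛-distribˡ (ℚ[y].var ^′ n) (f n) (g n) m

σ-‿- : ∀ f g → σ (f - g) ≈ σ f - σ g
σ-‿- f g n m = begin
  σ (f - g) n m                                     ≡⟨ σ-shift (f - g) n m ⟩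
  shift n ((f - g) n) m                             ≡⟨ go n (f n) (g n) m ⟩
  shift n (f n) m ℚ.- shift n (g n) m               ≡⟨ cong₂ ℚ._-_ (σ-shift f n m) (σ-shift g n m) ⟨
  (σ f - σ g) n m                                   ∎
  where
  open ≡-Reasoning
  go : ∀ n s t m → shift n (λ m → s m ℚ.- t m) m ≡ shift n s m ℚ.- shift n t m
  go zero    s t m       = refl
  go (suc n) s t zero    = refl
  go (suc n) s t (suc m) = go n s t m

σ-const : ∀ c → σ (const c) ≈ const c
σ-const c n m = trans (σ-shift (const c) n m) (go n m)
  where
  zeros : ∀ n m → shift n (λ _ → 0ℚ) m ≡ 0ℚ
  zeros zero    m       = refl
  zeros (suc n) zero    = refl
  zeros (suc n) (suc m) = zeros n m
  go : ∀ n m → shift n (const c n) m ≡ const c n m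
  go zero    m       = refl
  go (suc n) zero    = refl
  go (suc n) (suc m) = zeros n m

σ-x : σ x ≈ x * y
σ-x n m = trans (σ-shift x n m) (go n m)
  where
  zeros : ∀ k n m → shift k (x (suc (suc n))) m ≡ 0ℚ
  zeros zero    n zero    = refl
  zeros zero    n (suc m) = refl
  zeros (suc k) n zero    = refl
  zeros (suc k) n (suc m) = zeros k n m
  go : ∀ n m → shift n (x n) m ≡ (x * y) n m
  go zero          zero          = refl
  go zero          (suc m)       = sym (x-*-zero y (suc m))
  go (suc zero)    zero          = sym (x-*-suc y 0 0)
  go (suc zero)    (suc zero)    = sym (x-*-suc y 0 1)
  go (suc zero)    (suc (suc m)) = sym (x-*-suc y 0 (suc (suc m)))
  go (suc (suc n)) m             = trans (zeros (suc (suc n)) n m) (sym (x-*-suc y (suc n) m))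

σ-θ : ∀ f → σ (θ f) ≈ θ (σ f)
σ-θ f n m = begin
  σ (θ f) n m              ≡⟨ σ-shift (θ f) n m ⟩
  shift n (θ f n) m        ≡⟨ go n (f n) m ⟩
  ι n ℚ.* shift n (f n) m  ≡⟨ cong (ι n ℚ.*_) (σ-shift f n m) ⟨
  θ (σ f) n m              ∎
  where
  open ≡-Reasoning
  go : ∀ k s m → shift k (λ m → ι n ℚ.* s m) m ≡ ι n ℚ.* shift k s m
  go zero    s m       = refl
  go (suc k) s zero    = sym (ℚ.*-zeroʳ (ι n))
  go (suc k) s (suc m) = go k s m

σ-1-x : σ (# 1 - x) ≈ # 1 - x * y
σ-1-x = ≈-trans (σ-‿- (# 1) x) (-‿cong {σ (# 1)} {# 1} {σ x} {x * y} (σ-const 1ℚ) σ-x)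

-- The basic inverses and logarithms.

R S A B : Series
R = inverse (# 1 - x)
S = inverse (# 1 - x * y)
A = ln (# 1 - x)
B = ln (# 1 - x * y)

1-x-row₀ : ∀ m → (# 1 - x) 0 m ≡ (# 1) 0 m
1-x-row₀ zero    = refl
1-x-row₀ (suc m) = refl

A-row₀ : ∀ m → A 0 m ≡ 0ℚ
A-row₀ = ln-row₀ (# 1 - x) 1-x-row₀

-- No substitution into a composition is needed: `σ` commutes with `θ` and with products, so `σ A`
-- satisfies the equation that characterises ln (1 - xy).
B≈σA : B ≈ σ A
B≈σA = ln-unique (# 1 - x * y) (σ A)
  (λ m → trans (cong (λ q → (# 1) 0 m ℚ.- q) (x-*-zero y m)) (ℚ.+-identityʳ _))
  (λ m → trans (σ-shift A 0 m) (A-row₀ m))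
  (begin
    (# 1 - x * y) * θ (σ A)      ≈⟨ *-cong {# 1 - x * y} {σ (# 1 - x)} {θ (σ A)} {σ (θ A)} (≈-sym σ-1-x) (≈-sym (σ-θ A)) ⟩
    σ (# 1 - x) * σ (θ A)        ≈⟨ σ-* (# 1 - x) (θ A) ⟨
    σ ((# 1 - x) * θ A)          ≈⟨ σ-cong (ln-θ (# 1 - x)) ⟩
    σ (θ (# 1 - x))              ≈⟨ σ-θ (# 1 - x) ⟩
    θ (σ (# 1 - x))              ≈⟨ θ-cong σ-1-x ⟩
    θ (# 1 - x * y)              ∎)
  where open ≈-Reasoning

S≈σR : S ≈ σ R
S≈σR = cancelˡ (# 1 - x * y) {S} {σ R} (begin
  (# 1 - x * y) * S      ≈⟨ *-comm (# 1 - x * y) S ⟩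
  S * (# 1 - x * y)      ≈⟨ inverse-* (# 1 - x * y) ⟩
  # 1                    ≈⟨ σ-const 1ℚ ⟨
  σ (# 1)                ≈⟨ σ-cong (inverse-* (# 1 - x)) ⟨
  σ (R * (# 1 - x))      ≈⟨ σ-* R (# 1 - x) ⟩
  σ R * σ (# 1 - x)      ≈⟨ *-congˡ (σ R) σ-1-x ⟩
  σ R * (# 1 - x * y)    ≈⟨ *-comm (σ R) (# 1 - x * y) ⟩
  (# 1 - x * y) * σ R    ∎)
  where open ≈-Reasoning

-- The quotient rule q · θ f = θ (f q) - f · θ q, with f q = p, shows that `A - B` satisfies the
-- equation characterising ln f.
ln-quotient : ln ((# 1 - x) / (# 1 - x * y)) ≈ A - B
ln-quotient = ln-unique f (A - B) f-row₀
  (λ m → cong₂ ℚ._-_ (A-row₀ m) (trans (B≈σA 0 m) (trans (σ-shift A 0 m) (A-row₀ m))))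
  (cancelˡ q {f * θ (A - B)} {θ f} (begin
    q * (f * θ (A - B))
      ≈⟨ *-congˡ q (*-congˡ f (θ-‿- A B)) ⟩
    q * (f * (θ A - θ B))
      ≈⟨ solve 4 (λ q f a b → q :* (f :* (a :- b)) := (f :* q) :* a :- f :* (q :* b)) (λ _ _ → refl) q f (θ A) (θ B) ⟩
    (f * q) * θ A - f * (q * θ B)
      ≈⟨ -‿cong {(f * q) * θ A} {p * θ A} {f * (q * θ B)} {f * θ q} (*-congʳ (θ A) fq≈p) (*-congˡ f (ln-θ q)) ⟩
    p * θ A - f * θ q
      ≈⟨ -‿cong {p * θ A} {θ (f * q)} {f * θ q} {f * θ q} (≈-trans (ln-θ p) (θ-cong (≈-sym fq≈p))) ≈-refl ⟩
    θ (f * q) - f * θ q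
      ≈⟨ -‿cong {θ (f * q)} {θ f * q + f * θ q} {f * θ q} {f * θ q} (θ-* f q) ≈-refl ⟩
    θ f * q + f * θ q - f * θ q
      ≈⟨ solve 4 (λ f q a b → a :* q :+ f :* b :- f :* b := q :* a) (λ _ _ → refl) f q (θ f) (θ q) ⟩
    q * θ f ∎))
  where
  open ≈-Reasoning
  p = # 1 - x
  q = # 1 - x * y
  f = p / q
  fq≈p : f * q ≈ p
  fq≈p = begin
    p * S * q     ≈⟨ *-assoc p S q ⟩
    p * (S * q)   ≈⟨ *-congˡ p (inverse-* q) ⟩
    p * # 1       ≈⟨ solve 1 (λ p → p :* con 1ℚ := p) (λ _ _ → refl) p ⟩
    p             ∎
  f-row₀ : ∀ m → f 0 m ≡ (# 1) 0 m
  -- In row 0 the factor 1 - xy acts as 1, so there f agrees with f q = p.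
  f-row₀ m = ≡.trans (≡.sym (≡.trans (cong (λ q → f 0 m ℚ.- q) (x-*-zero (y * f) m)) (ℚ.+-identityʳ (f 0 m))))
    (≡.trans ((solve 3 (λ f x y → f :- x :* (y :* f) := f :* (con 1ℚ :- x :* y)) (λ _ _ → refl) f x y) 0 m)
      (≡.trans (fq≈p 0 m) (1-x-row₀ m)))

-- Series with coefficients built from reciprocals.

module ℚR = Data.Rational.Solver.+-*-Solver

1-x-*-zero : ∀ f m → ((# 1 - x) * f) 0 m ≡ f 0 m
1-x-*-zero f m = trans (expand 0 m) (trans (cong (λ q → f 0 m ℚ.- q) (x-*-zero f m)) (ℚ.+-identityʳ (f 0 m)))
  where expand = solve 2 (λ x f → (con 1ℚ :- x) :* f := f :- x :* f) (λ _ _ → refl) x f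

1-x-*-suc : ∀ f n m → ((# 1 - x) * f) (suc n) m ≡ f (suc n) m ℚ.- f n m
1-x-*-suc f n m = trans (expand (suc n) m) (cong (λ q → f (suc n) m ℚ.- q) (x-*-suc f n m))
  where expand = solve 2 (λ x f → (con 1ℚ :- x) :* f := f :- x :* f) (λ _ _ → refl) x f

1-y-*-zero : ∀ f n → ((# 1 - y) * f) n 0 ≡ f n 0
1-y-*-zero f n = trans (expand n 0) (trans (cong (λ q → f n 0 ℚ.- q) (y-*-zero f n)) (ℚ.+-identityʳ (f n 0)))
  where expand = solve 2 (λ y f → (con 1ℚ :- y) :* f := f :- y :* f) (λ _ _ → refl) y f

1-y-*-suc : ∀ f n m → ((# 1 - y) * f) n (suc m) ≡ f n (suc m) ℚ.- f n m
1-y-*-suc f n m = trans (expand n (suc m)) (cong (λ q → f n (suc m) ℚ.- q) (y-*-suc f n m))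
  where expand = solve 2 (λ y f → (con 1ℚ :- y) :* f := f :- y :* f) (λ _ _ → refl) y f

monomial : ℚ → ℕ → ℚ
monomial q zero    = q
monomial q (suc _) = 0ℚ

-- ∑ₙ aₙ xⁿ
ogf : (ℕ → ℚ) → Series
ogf a n = monomial (a n)

-- 1/n, with the junk value 0 at n = 0.
recip : ℕ → ℚ
recip zero    = 0ℚ
recip (suc n) = + 1 ℚ./ suc n

ι*recip : ∀ n → ι (suc n) ℚ.* recip (suc n) ≡ 1ℚ
ι*recip n = trans (ℚ.*-comm (ι (suc n)) (recip (suc n))) (/-cancel (+ 1) (suc n))

-- Partial fractions, from (1 + i) b = 1 and i a = 1 with i = n + 1.
recip-telescope : ∀ n → recip (suc (suc n)) ℚ.* recip (suc n) ≡ recip (suc n) ℚ.- recip (suc (suc n))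
recip-telescope n = begin
  b ℚ.* a
    ≡⟨ solve′ 3 (λ a b i → b :*′ a :=′ a :*′ ((con′ 1ℚ :+′ i) :*′ b) :-′ b :*′ (i :*′ a)) refl a b i ⟩
  a ℚ.* ((1ℚ ℚ.+ i) ℚ.* b) ℚ.- b ℚ.* (i ℚ.* a)
    ≡⟨ cong₂ (λ p q → a ℚ.* p ℚ.- b ℚ.* q)
         (trans (cong (ℚ._* b) (sym (ι-+ 1 (suc n)))) (ι*recip (suc n))) (ι*recip n) ⟩
  a ℚ.* 1ℚ ℚ.- b ℚ.* 1ℚ
    ≡⟨ cong₂ ℚ._-_ (ℚ.*-identityʳ a) (ℚ.*-identityʳ b) ⟩
  a ℚ.- b ∎
  where
  open ≡-Reasoning
  open ℚR using () renaming (solve to solve′; _:*_ to _:*′_; _:+_ to _:+′_; _:-_ to _:-′_; _:=_ to _:=′_; con to con′)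
  a = recip (suc n)
  b = recip (suc (suc n))
  i = ι (suc n)

A≈ogf : A ≈ ogf (λ n → ℚ.- recip n)
A≈ogf = ln-unique (# 1 - x) (ogf λ n → ℚ.- recip n) 1-x-row₀ (λ { zero → refl ; (suc _) → refl }) coefficients
  where
  ℓ = ogf λ n → ℚ.- recip n
  θℓ-suc : ∀ n m → θ ℓ (suc n) m ≡ monomial (ℚ.- 1ℚ) m
  θℓ-suc n zero    = trans (sym (ℚ.neg-distribʳ-* (ι (suc n)) (recip (suc n)))) (cong ℚ.-_ (ι*recip n))
  θℓ-suc n (suc m) = ℚ.*-zeroʳ (ι (suc n))
  coefficients : (# 1 - x) * θ ℓ ≈ θ (# 1 - x)
  coefficients zero          m = trans (1-x-*-zero (θ ℓ) m) (trans (ℚ.*-zeroˡ (ℓ 0 m)) (sym (ℚ.*-zeroˡ ((# 1 - x) 0 m))))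
  coefficients (suc zero)    zero = trans (1-x-*-suc (θ ℓ) 0 0) refl
  coefficients (suc zero)    (suc m) = trans (1-x-*-suc (θ ℓ) 0 (suc m)) refl
  coefficients (suc (suc n)) m = trans (1-x-*-suc (θ ℓ) (suc n) m) (trans
    (cong₂ ℚ._-_ (θℓ-suc (suc n) m) (θℓ-suc n m)) (trans (ℚ.+-inverseʳ (monomial (ℚ.- 1ℚ) m))
      (sym (trans (cong (ι (suc (suc n)) ℚ.*_) (1-x-coefficient m)) (ℚ.*-zeroʳ (ι (suc (suc n))))))))
    where
    1-x-coefficient : ∀ m → (# 1 - x) (suc (suc n)) m ≡ 0ℚ
    1-x-coefficient zero    = refl
    1-x-coefficient (suc _) = refl

R≈ogf : R ≈ ogf (λ _ → 1ℚ)
R≈ogf = cancelˡ (# 1 - x) {R} {ogf λ _ → 1ℚ} (≈-trans (*-comm (# 1 - x) R)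
  (≈-trans (inverse-* (# 1 - x)) (≈-sym coefficients)))
  where
  coefficients : (# 1 - x) * ogf (λ _ → 1ℚ) ≈ # 1
  coefficients zero    zero    = 1-x-*-zero (ogf λ _ → 1ℚ) 0
  coefficients zero    (suc m) = 1-x-*-zero (ogf λ _ → 1ℚ) (suc m)
  coefficients (suc n) m       =
    trans (1-x-*-suc (ogf λ _ → 1ℚ) n m) (ℚ.+-inverseʳ (monomial 1ℚ m))

-- 1/(n(n - 1)) for n ≥ 2, and 0 for n ≤ 1.
recip₂ : ℕ → ℚ
recip₂ n = recip n ℚ.* recip (ℕ.pred n)

-- Since 1/(n (n - 1)) = 1/(n - 1) - 1/n, this is (1 - x) ln (1 - x) except at n = 1, where that
-- product has coefficient -1 and the summand x corrects it to 0.
ogf-recip₂ : ogf recip₂ ≈ x + (# 1 - x) * A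
ogf-recip₂ = ≈-trans coefficients (+-congˡ x (*-congˡ (# 1 - x) (≈-sym A≈ogf)))
  where
  ℓ = ogf λ n → ℚ.- recip n
  coefficients : ogf recip₂ ≈ x + (# 1 - x) * ℓ
  coefficients zero zero = cong (0ℚ ℚ.+_) (sym (1-x-*-zero ℓ 0))
  coefficients zero (suc m) = cong (0ℚ ℚ.+_) (sym (1-x-*-zero ℓ (suc m)))
  coefficients (suc zero) zero = cong (1ℚ ℚ.+_) (sym (1-x-*-suc ℓ 0 0))
  coefficients (suc zero) (suc m) = cong (0ℚ ℚ.+_) (sym (1-x-*-suc ℓ 0 (suc m)))
  coefficients (suc (suc n)) zero = trans (trans (recip-telescope n)
      (ℚR.solve 2 (λ a b → a ℚR.:- b ℚR.:= ℚR.con 0ℚ ℚR.:+ (ℚR.:- b ℚR.:- ℚR.:- a)) refl (recip (suc n)) (recip (suc (suc n)))))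
    (cong (0ℚ ℚ.+_) (sym (1-x-*-suc ℓ (suc n) 0)))
  coefficients (suc (suc n)) (suc m) = cong (0ℚ ℚ.+_) (sym (1-x-*-suc ℓ (suc n) (suc m)))

-- 1/n for n ≥ 2, and 0 for n ≤ 1.
recip≥2 : ℕ → ℚ
recip≥2 n = ι (ℕ.pred n) ℚ.* recip₂ n

ogf-recip≥2 : ogf recip≥2 ≈ # 0 - A - x
ogf-recip≥2 = ≈-trans coefficients λ n m → cong (λ q → (# 0) n m ℚ.- q ℚ.- x n m) (sym (A≈ogf n m))
  where
  ℓ = ogf λ n → ℚ.- recip n
  coefficients : ogf recip≥2 ≈ # 0 - ℓ - x
  coefficients zero zero = refl
  coefficients zero (suc m) = refl
  coefficients (suc zero) zero = refl
  coefficients (suc zero) (suc m) = refl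
  coefficients (suc (suc n)) zero = begin
    ι (suc n) ℚ.* (b ℚ.* a)        ≡⟨ ℚR.solve 3 (λ i b a → i ℚR.:* (b ℚR.:* a) ℚR.:= (i ℚR.:* a) ℚR.:* b) refl (ι (suc n)) b a ⟩
    ι (suc n) ℚ.* a ℚ.* b          ≡⟨ cong (ℚ._* b) (ι*recip n) ⟩
    1ℚ ℚ.* b                       ≡⟨ ℚR.solve 1 (λ b → ℚR.con 1ℚ ℚR.:* b ℚR.:= ℚR.con 0ℚ ℚR.:- ℚR.:- b ℚR.:- ℚR.con 0ℚ) refl b ⟩
    0ℚ ℚ.- (ℚ.- b) ℚ.- 0ℚ          ∎
    where
    open ≡-Reasoning
    a = recip (suc n)
    b = recip (suc (suc n))
  coefficients (suc (suc n)) (suc m) = refl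

-- For n ≥ 1 this is (n - 1)! (n - 1)/n!, the normalised number of all adjacent pairs in the
-- sequences of length n with a fixed last letter.
ratio : ℕ → ℚ
ratio n = ι (ℕ.pred n) ℚ.* recip n

ogf-ratio : ogf ratio ≈ x * R + A
ogf-ratio = ≈-trans coefficients (+-cong (*-congˡ x (≈-sym R≈ogf)) (≈-sym A≈ogf))
  where
  ℓ = ogf λ n → ℚ.- recip n
  coefficients : ogf ratio ≈ x * ogf (λ _ → 1ℚ) + ℓ
  coefficients zero    zero    = cong (ℚ._+ ℚ.- 0ℚ) (sym (x-*-zero (ogf λ _ → 1ℚ) 0))
  coefficients zero    (suc m) = cong (ℚ._+ 0ℚ) (sym (x-*-zero (ogf λ _ → 1ℚ) (suc m)))
  coefficients (suc n) zero    = trans (begin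
    ι n ℚ.* a                     ≡⟨ ℚR.solve 2 (λ i a → i ℚR.:* a ℚR.:= (ℚR.con 1ℚ ℚR.:+ i) ℚR.:* a ℚR.:+ ℚR.:- a) refl (ι n) a ⟩
    (1ℚ ℚ.+ ι n) ℚ.* a ℚ.- a      ≡⟨ cong (λ q → q ℚ.* a ℚ.- a) (ι-+ 1 n) ⟨
    ι (suc n) ℚ.* a ℚ.- a         ≡⟨ cong (ℚ._- a) (ι*recip n) ⟩
    1ℚ ℚ.- a                      ∎) (cong (ℚ._- a) (sym (x-*-suc (ogf λ _ → 1ℚ) n 0)))
    where
    open ≡-Reasoning
    a = recip (suc n)
  coefficients (suc n) (suc m) = cong (ℚ._+ 0ℚ) (sym (x-*-suc (ogf λ _ → 1ℚ) n (suc m)))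

-- Row sums over the last letter and their multiplication by 1 - y.

below : ℕ → ℚ → ℕ → ℚ
below n q m = if m ℕ.<ᵇ n then q else 0ℚ

-- The entry φ may depend on m because the entries of `V-U` do.
below-suc : ∀ (φ : ℕ → ℚ) n m →
            below (suc n) (φ m) m ≡ below n (φ m) m ℚ.+ shift n (monomial (φ n)) m
below-suc φ zero    zero    = sym (ℚ.+-identityˡ (φ 0))
below-suc φ zero    (suc m) = refl
below-suc φ (suc n) zero    = sym (ℚ.+-identityʳ (φ 0))
below-suc φ (suc n) (suc m) = below-suc (λ k → φ (suc k)) n m

-- ∑ₙ aₙ xⁿ (y + y² + ⋯ + yⁿ)
rows : (ℕ → ℚ) → Series
rows a n zero    = 0ℚ
rows a n (suc m) = below n (a n) m

-- The geometric sum (1 - y)(y + ⋯ + yⁿ) = y (1 - yⁿ), where xⁿyⁿ is the image of xⁿ under `σ`.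
1-y-*-rows : ∀ a → (# 1 - y) * rows a ≈ y * (ogf a - σ (ogf a))
1-y-*-rows a n zero    = trans (1-y-*-zero (rows a) n) (sym (y-*-zero (ogf a - σ (ogf a)) n))
1-y-*-rows a n (suc m) = trans (1-y-*-suc (rows a) n m)
  (trans (step n m) (sym (trans (y-*-suc (ogf a - σ (ogf a)) n m) (cong (λ q → ogf a n m ℚ.- q) (σ-shift (ogf a) n m)))))
  where
  step : ∀ n m → rows a n (suc m) ℚ.- rows a n m ≡ ogf a n m ℚ.- shift n (ogf a n) m
  step zero    zero    = sym (ℚ.+-inverseʳ (a 0))
  step zero    (suc m) = refl
  step (suc n) zero    = refl
  step (suc n) (suc m) = trans
    (cong (λ q → below n (a (suc n)) m ℚ.- q) (below-suc (λ _ → a (suc n)) n m))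
    (ℚR.solve 2 (λ b s → b ℚR.:- (b ℚR.:+ s) ℚR.:= ℚR.con 0ℚ ℚR.:- s) refl
      (below n (a (suc n)) m) (shift n (ogf a (suc n)) m))

-- The levels (respectively ascents) formed by the last two letters.
V-L : Series
V-L n zero    = 0ℚ
V-L n (suc m) = below (ℕ.pred n) (recip₂ n) m

-- The last letter n forms no level, because the letter before it is at most n - 1. Hence the top
-- power yⁿ is missing from the row, and `σ` supplies exactly the terms xⁿyⁿ to be removed.
V-L≈ : V-L ≈ rows recip₂ - σ (ogf recip₂)
V-L≈ n m = trans (step n m) (cong (λ q → rows recip₂ n m ℚ.- q) (sym (σ-shift (ogf recip₂) n m)))
  where
  step : ∀ n m → V-L n m ≡ rows recip₂ n m ℚ.- shift n (ogf recip₂ n) m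
  step zero    zero    = refl
  step zero    (suc m) = refl
  step (suc n) zero    = refl
  step (suc n) (suc m) = trans
    (ℚR.solve 2 (λ b s → b ℚR.:= (b ℚR.:+ s) ℚR.:- s) refl (below n (recip₂ (suc n)) m) (shift n (ogf recip₂ (suc n)) m))
    (cong (ℚ._- shift n (ogf recip₂ (suc n)) m) (sym (below-suc (λ _ → recip₂ (suc n)) n m)))

V-U : Series
V-U n zero    = 0ℚ
V-U n (suc m) = below n (ι m ℚ.* recip₂ n) m

-- The entries (j - 1)/(n (n - 1)) rise in j by a constant step. Their differences form a row of
-- `recip₂` without its entry at j = 1, and the drop from (n - 1)/(n (n - 1)) to 0 after j = n
-- yields `recip≥2`.
1-y-*-V-U : (# 1 - y) * V-U ≈ rows recip₂ - y * ogf recip₂ - y * σ (ogf recip≥2)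
1-y-*-V-U n zero    = trans (1-y-*-zero V-U n)
  (sym (cong₂ (λ p q → 0ℚ ℚ.- p ℚ.- q) (y-*-zero (ogf recip₂) n) (y-*-zero (σ (ogf recip≥2)) n)))
1-y-*-V-U n (suc m) = trans (1-y-*-suc V-U n m) (trans (step n m)
  (sym (cong₂ (λ p q → below n (recip₂ n) m ℚ.- p ℚ.- q) (y-*-suc (ogf recip₂) n m)
    (trans (y-*-suc (σ (ogf recip≥2)) n m) (σ-shift (ogf recip≥2) n m)))))
  where
  below-ι : ∀ n q m → below n (ι (suc m) ℚ.* q) m ℚ.- below n (ι m ℚ.* q) m ≡ below n q m
  below-ι n q m with m ℕ.<ᵇ n
  ... | true  = trans (cong (λ i → i ℚ.* q ℚ.- ι m ℚ.* q) (ι-+ 1 m))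
    (ℚR.solve 2 (λ i q → (ℚR.con 1ℚ ℚR.:+ i) ℚR.:* q ℚR.:- i ℚR.:* q ℚR.:= q) refl (ι m) q)
  ... | false = refl
  step : ∀ n m → V-U n (suc m) ℚ.- V-U n m ≡ below n (recip₂ n) m ℚ.- ogf recip₂ n m ℚ.- shift n (ogf recip≥2 n) m
  step zero    zero    = refl
  step zero    (suc m) = refl
  step (suc n) zero    =
    ℚR.solve 1 (λ q → ℚR.con 0ℚ ℚR.:* q ℚR.:- ℚR.con 0ℚ ℚR.:= q ℚR.:- q ℚR.:- ℚR.con 0ℚ) refl (recip₂ (suc n))
  step (suc n) (suc m) = begin
    below n (ι (suc m) ℚ.* q) m ℚ.- below (suc n) (ι m ℚ.* q) m
      ≡⟨ cong (λ p → below n (ι (suc m) ℚ.* q) m ℚ.- p) (below-suc (λ k → ι k ℚ.* q) n m) ⟩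
    below n (ι (suc m) ℚ.* q) m ℚ.- (below n (ι m ℚ.* q) m ℚ.+ s)
      ≡⟨ ℚR.solve 3 (λ a b s → a ℚR.:- (b ℚR.:+ s) ℚR.:= (a ℚR.:- b) ℚR.:- ℚR.con 0ℚ ℚR.:- s) refl
           (below n (ι (suc m) ℚ.* q) m) (below n (ι m ℚ.* q) m) s ⟩
    below n (ι (suc m) ℚ.* q) m ℚ.- below n (ι m ℚ.* q) m ℚ.- 0ℚ ℚ.- s
      ≡⟨ cong (λ p → p ℚ.- 0ℚ ℚ.- s) (below-ι n q m) ⟩
    below n q m ℚ.- 0ℚ ℚ.- s ∎
    where
    open ≡-Reasoning
    q = recip₂ (suc n)
    s = shift n (ogf recip≥2 (suc n)) m

-- Adding a multiple of p - q lets a single ring normalisation use the relation p ≈ q.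
modulo : ∀ {p q} → p ≈ q → ∀ f g c → f ≈ g + c * (p - q) → f ≈ g
modulo {p} {q} p≈q f g c f≈ = begin
  f                 ≈⟨ f≈ ⟩
  g + c * (p - q)   ≈⟨ +-congˡ g (*-congˡ c (-‿cong {p} {q} {q} {q} p≈q ≈-refl)) ⟩
  g + c * (q - q)   ≈⟨ solve 3 (λ g c q → g :+ c :* (q :- q) := g) (λ _ _ → refl) g c q ⟩
  g                 ∎
  where open ≈-Reasoning

-- Integration of the series of normalised totals.

½ : Series
½ = const ℚ.½

R-relation : R * (# 1 - x) ≈ # 1
R-relation = inverse-* (# 1 - x)

S-relation : S * (# 1 - x * y) ≈ # 1
S-relation = inverse-* (# 1 - x * y)

θ-x : θ x ≈ x
θ-x zero          m       = trans (ℚ.*-zeroˡ (x 0 m)) (row₀ m)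
  where
  row₀ : ∀ m → 0ℚ ≡ x 0 m
  row₀ zero    = refl
  row₀ (suc _) = refl
θ-x (suc zero)    m       = ℚ.*-identityˡ (x 1 m)
θ-x (suc (suc n)) zero    = ℚ.*-zeroʳ (ι (suc (suc n)))
θ-x (suc (suc n)) (suc m) = ℚ.*-zeroʳ (ι (suc (suc n)))

θ-1-x : θ (# 1 - x) ≈ # 0 - x
θ-1-x = begin
  θ (# 1 - x)      ≈⟨ θ-‿- (# 1) x ⟩
  θ (# 1) - θ x    ≈⟨ -‿cong {θ (# 1)} {# 0} {θ x} {x} (≈-trans θ-1 0ₛ-const) θ-x ⟩
  # 0 - x          ∎
  where open ≈-Reasoning

θ-A : (# 1 - x) * θ A ≈ # 0 - x
θ-A = ≈-trans (ln-θ (# 1 - x)) θ-1-x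

θ-R : θ R * (# 1 - x) ≈ x * R
θ-R = begin
  θ R * (# 1 - x)
    ≈⟨ solve 3 (λ t x recip → t :* (con 1ℚ :- x) := t :* (con 1ℚ :- x) :+ recip :* (con 0ℚ :- x) :+ x :* recip) (λ _ _ → refl) (θ R) x R ⟩
  θ R * (# 1 - x) + R * (# 0 - x) + x * R
    ≈⟨ +-congʳ (x * R) (+-congˡ (θ R * (# 1 - x)) (*-congˡ R (≈-sym θ-1-x))) ⟩
  θ R * (# 1 - x) + R * θ (# 1 - x) + x * R
    ≈⟨ +-congʳ (x * R) (θ-* R (# 1 - x)) ⟨
  θ (R * (# 1 - x)) + x * R
    ≈⟨ +-congʳ (x * R) (≈-trans (θ-cong R-relation) (≈-trans θ-1 0ₛ-const)) ⟩
  # 0 + x * R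
    ≈⟨ solve 1 (λ f → con 0ℚ :+ f := f) (λ _ _ → refl) (x * R) ⟩
  x * R ∎
  where open ≈-Reasoning

row₀-* : ∀ f g → (∀ m → f 0 m ≡ 0ℚ) → ∀ m → (f * g) 0 m ≡ 0ℚ
row₀-* f g f₀≡0 m = ∑≤-zero m λ {j} _ →
  trans (cong (ℚ._* g 0 (m ℕ.∸ j)) (f₀≡0 j)) (ℚ.*-zeroˡ (g 0 (m ℕ.∸ j)))

x-row₀ : ∀ m → x 0 m ≡ 0ℚ
x-row₀ zero    = refl
x-row₀ (suc _) = refl

-- The coefficients of the integral from 0 to x of ∑ₙ tₙ xⁿ.
integral : (ℕ → ℚ) → ℕ → ℚ
integral t n = recip n ℚ.* t (ℕ.pred n)

θ-integral : ∀ t → θ (ogf (integral t)) ≈ x * ogf t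
θ-integral t zero    m       = trans (ℚ.*-zeroˡ (ogf (integral t) 0 m)) (sym (x-*-zero (ogf t) m))
θ-integral t (suc n) zero    = trans (sym (ℚ.*-assoc (ι (suc n)) (recip (suc n)) (t n)))
  (trans (cong (ℚ._* t n) (ι*recip n)) (trans (ℚ.*-identityˡ (t n)) (sym (x-*-suc (ogf t) n 0))))
θ-integral t (suc n) (suc m) = trans (ℚ.*-zeroʳ (ι (suc n))) (sym (x-*-suc (ogf t) n (suc m)))

-- Both sides have the same image under `θ`. The factor 1 - x stays in the hypothesis because the
-- series of t is known only through its product with 1 - x.
integral-unique : ∀ t f → (∀ m → f 0 m ≡ 0ℚ) → (# 1 - x) * θ f ≈ x * ((# 1 - x) * ogf t) → ogf (integral t) ≈ f
integral-unique t f f₀≡0 eq = θ-injective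
  (λ m → trans (integral₀ m) (sym (f₀≡0 m)))
  (cancelˡ (# 1 - x) {θ (ogf (integral t))} {θ f} (begin
    (# 1 - x) * θ (ogf (integral t))  ≈⟨ *-congˡ (# 1 - x) (θ-integral t) ⟩
    (# 1 - x) * (x * ogf t)           ≈⟨ solve 3 (λ p x t → p :* (x :* t) := x :* (p :* t)) (λ _ _ → refl) (# 1 - x) x (ogf t) ⟩
    x * ((# 1 - x) * ogf t)           ≈⟨ eq ⟨
    (# 1 - x) * θ f                 ∎))
  where
  open ≈-Reasoning
  integral₀ : ∀ m → ogf (integral t) 0 m ≡ 0ℚ
  integral₀ zero    = ℚ.*-zeroˡ (t 0)
  integral₀ (suc m) = refl

-- The integrand is (-A - x)/(1 - x). As A has derivative -1/(1 - x), its first part integrates to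
-- A²/2 and its second part to A + x.
integral-L : ∀ t → (# 1 - x) * ogf t ≈ # 0 - A - x → ogf (integral t) ≈ ½ * (A * A) + A + x
integral-L t hyp = integral-unique t (½ * (A * A) + A + x) row₀ (begin
  (# 1 - x) * θ (½ * (A * A) + A + x)
    ≈⟨ *-congˡ (# 1 - x) θ-expand ⟩
  (# 1 - x) * (½ * (θ A * A + A * θ A) + θ A + x)
    -- The multiplier `A + # 1` is the coefficient of `θ A` in the derivative of A²/2 + A.
    ≈⟨ modulo θ-A ((# 1 - x) * (½ * (θ A * A + A * θ A) + θ A + x)) (x * (# 0 - A - x)) (A + # 1)
         (solve 3 (λ x a t → (con 1ℚ :- x) :* (con ℚ.½ :* (t :* a :+ a :* t) :+ t :+ x) :=
             x :* (con 0ℚ :- a :- x) :+ (a :+ con 1ℚ) :* ((con 1ℚ :- x) :* t :- (con 0ℚ :- x)))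
           (λ _ _ → refl) x A (θ A)) ⟩
  x * (# 0 - A - x)
    ≈⟨ *-congˡ x hyp ⟨
  x * ((# 1 - x) * ogf t) ∎)
  where
  open ≈-Reasoning
  row₀ : ∀ m → (½ * (A * A) + A + x) 0 m ≡ 0ℚ
  row₀ m = cong₂ ℚ._+_ (cong₂ ℚ._+_
    (trans (*-comm ½ (A * A) 0 m) (row₀-* (A * A) ½ (row₀-* A A A-row₀) m)) (A-row₀ m)) (x-row₀ m)
  θ-expand : θ (½ * (A * A) + A + x) ≈ ½ * (θ A * A + A * θ A) + θ A + x
  θ-expand = begin
    θ (½ * (A * A) + A + x)                  ≈⟨ θ-+ (½ * (A * A) + A) x ⟩
    θ (½ * (A * A) + A) + θ x                ≈⟨ +-cong (θ-+ (½ * (A * A)) A) θ-x ⟩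
    θ (½ * (A * A)) + θ A + x                ≈⟨ +-congʳ x (+-congʳ (θ A) (θ-const ℚ.½ (A * A))) ⟩
    ½ * θ (A * A) + θ A + x                  ≈⟨ +-congʳ x (+-congʳ (θ A) (*-congˡ ½ (θ-* A A))) ⟩
    ½ * (θ A * A + A * θ A) + θ A + x        ∎

-- The integrand is half of x²/(1 - x)² = 1 - 2/(1 - x) + 1/(1 - x)², which integrates to x + 2 A +
-- x R.
integral-U : ∀ t → (# 1 - x) * ogf t ≈ ½ * (x * (x * R)) → ogf (integral t) ≈ ½ * (x * R) + A + ½ * x
integral-U t hyp = integral-unique t (½ * (x * R) + A + ½ * x) row₀ (begin
  (# 1 - x) * θ (½ * (x * R) + A + ½ * x)
    ≈⟨ *-congˡ (# 1 - x) θ-expand ⟩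
  (# 1 - x) * (½ * (x * R + x * θ R) + θ A + ½ * x)
    ≈⟨ modulo θ-A _ _ (# 1) (modulo θ-R _ _ (½ * x) (modulo R-relation _ _ (½ * (x + x * x))
         (solve 4 (λ x recip a s → (con 1ℚ :- x) :* (con ℚ.½ :* (x :* recip :+ x :* s) :+ a :+ con ℚ.½ :* x) :=
             x :* (con ℚ.½ :* (x :* (x :* recip)))
             :+ con 1ℚ :* ((con 1ℚ :- x) :* a :- (con 0ℚ :- x))
             :+ con ℚ.½ :* x :* (s :* (con 1ℚ :- x) :- x :* recip)
             :+ con ℚ.½ :* (x :+ x :* x) :* (recip :* (con 1ℚ :- x) :- con 1ℚ))
           (λ _ _ → refl) x R (θ A) (θ R)))) ⟩
  x * (½ * (x * (x * R)))
    ≈⟨ *-congˡ x hyp ⟨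
  x * ((# 1 - x) * ogf t) ∎)
  where
  open ≈-Reasoning
  row₀ : ∀ m → (½ * (x * R) + A + ½ * x) 0 m ≡ 0ℚ
  row₀ m = cong₂ ℚ._+_ (cong₂ ℚ._+_
    (trans (*-comm ½ (x * R) 0 m) (row₀-* (x * R) ½ (row₀-* x R x-row₀) m)) (A-row₀ m))
    (trans (*-comm ½ x 0 m) (row₀-* x ½ x-row₀ m))
  θ-expand : θ (½ * (x * R) + A + ½ * x) ≈ ½ * (x * R + x * θ R) + θ A + ½ * x
  θ-expand = begin
    θ (½ * (x * R) + A + ½ * x)              ≈⟨ θ-+ (½ * (x * R) + A) (½ * x) ⟩
    θ (½ * (x * R) + A) + θ (½ * x)          ≈⟨ +-cong (θ-+ (½ * (x * R)) A) (≈-trans (θ-const ℚ.½ x) (*-congˡ ½ θ-x)) ⟩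
    θ (½ * (x * R)) + θ A + ½ * x            ≈⟨ +-congʳ (½ * x) (+-congʳ (θ A) (θ-const ℚ.½ (x * R))) ⟩
    ½ * θ (x * R) + θ A + ½ * x              ≈⟨ +-congʳ (½ * x) (+-congʳ (θ A) (*-congˡ ½ (θ-* x R))) ⟩
    ½ * (θ x * R + x * θ R) + θ A + ½ * x    ≈⟨ +-congʳ (½ * x) (+-congʳ (θ A) (*-congˡ ½ (+-congʳ (x * θ R) (*-congʳ R θ-x)))) ⟩
    ½ * (x * R + x * θ R) + θ A + ½ * x      ∎

-- The closed forms, with denominators cleared.

private
  d : Series
  d = # 1 - y

  -- The inverse denominators get names so that the solver can treat them as variables subject to
  -- `p-relation` and `q-relation`.
  p q : Series
  p = inverse (# 2 * (# 1 - y))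
  q = inverse ((# 1 - y) ^ 2)

σ-recip₂ : σ (ogf recip₂) ≈ x * y + (# 1 - x * y) * B
σ-recip₂ = begin
  σ (ogf recip₂)                           ≈⟨ σ-cong ogf-recip₂ ⟩
  σ (x + (# 1 - x) * A)             ≈⟨ σ-+ x ((# 1 - x) * A) ⟩
  σ x + σ ((# 1 - x) * A)           ≈⟨ +-cong σ-x (≈-trans (σ-* (# 1 - x) A) (*-cong {σ (# 1 - x)} {# 1 - x * y} {σ A} {B} σ-1-x (≈-sym B≈σA))) ⟩
  x * y + (# 1 - x * y) * B         ∎
  where open ≈-Reasoning

σ-recip≥2 : σ (ogf recip≥2) ≈ # 0 - B - x * y
σ-recip≥2 = begin
  σ (ogf recip≥2)               ≈⟨ σ-cong ogf-recip≥2 ⟩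
  σ (# 0 - A - x)        ≈⟨ σ-‿- (# 0 - A) x ⟩
  σ (# 0 - A) - σ x      ≈⟨ -‿cong {σ (# 0 - A)} {# 0 - B} {σ x} {x * y} (≈-trans (σ-‿- (# 0) A) (-‿cong {σ (# 0)} {# 0} {σ A} {B} (σ-const 0ℚ) (≈-sym B≈σA))) σ-x ⟩
  # 0 - B - x * y        ∎
  where open ≈-Reasoning

σ-xR : σ (x * R) ≈ x * y * S
σ-xR = ≈-trans (σ-* x R) (*-cong {σ x} {x * y} {σ R} {S} σ-x (≈-sym S≈σR))

rows-relation : ∀ a {f g} → ogf a ≈ f → σ f ≈ g → (# 1 - y) * rows a ≈ y * (f - g)
rows-relation a {f} {g} Pa≈f σf≈g = ≈-trans (1-y-*-rows a)
  (*-congˡ y (-‿cong {ogf a} {f} {σ (ogf a)} {g} Pa≈f (≈-trans (σ-cong Pa≈f) σf≈g)))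

rows-recip₂ : (# 1 - y) * rows recip₂ ≈ y * (x + (# 1 - x) * A - (x * y + (# 1 - x * y) * B))
rows-recip₂ = rows-relation recip₂ ogf-recip₂ (≈-trans (σ-cong (≈-sym ogf-recip₂)) σ-recip₂)

rows-ratio : (# 1 - y) * rows ratio ≈ y * (x * R + A - (x * y * S + B))
rows-ratio = rows-relation ratio ogf-ratio (≈-trans (σ-+ (x * R) A) (+-cong σ-xR (≈-sym B≈σA)))

rows-L : ∀ t → (# 1 - x) * ogf t ≈ # 0 - A - x →
      (# 1 - y) * rows (integral t) ≈ y * (½ * (A * A) + A + x - (½ * (B * B) + B + x * y))
rows-L t hyp = rows-relation (integral t) (integral-L t hyp) (begin
  σ (½ * (A * A) + A + x)           ≈⟨ σ-+ (½ * (A * A) + A) x ⟩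
  σ (½ * (A * A) + A) + σ x         ≈⟨ +-cong (σ-+ (½ * (A * A)) A) σ-x ⟩
  σ (½ * (A * A)) + σ A + x * y     ≈⟨ +-congʳ (x * y) (+-cong square (≈-sym B≈σA)) ⟩
  ½ * (B * B) + B + x * y           ∎)
  where
  open ≈-Reasoning
  square : σ (½ * (A * A)) ≈ ½ * (B * B)
  square = begin
    σ (½ * (A * A))    ≈⟨ σ-* ½ (A * A) ⟩
    σ ½ * σ (A * A)    ≈⟨ *-cong {σ ½} {½} {σ (A * A)} {σ A * σ A} (σ-const ℚ.½) (σ-* A A) ⟩
    ½ * (σ A * σ A)    ≈⟨ *-congˡ ½ (*-cong {σ A} {B} {σ A} {B} (≈-sym B≈σA) (≈-sym B≈σA)) ⟩
    ½ * (B * B)        ∎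

rows-U : ∀ t → (# 1 - x) * ogf t ≈ ½ * (x * (x * R)) →
      (# 1 - y) * rows (integral t) ≈ y * (½ * (x * R) + A + ½ * x - (½ * (x * y * S) + B + ½ * (x * y)))
rows-U t hyp = rows-relation (integral t) (integral-U t hyp) (begin
  σ (½ * (x * R) + A + ½ * x)             ≈⟨ σ-+ (½ * (x * R) + A) (½ * x) ⟩
  σ (½ * (x * R) + A) + σ (½ * x)         ≈⟨ +-cong (σ-+ (½ * (x * R)) A) (half x σ-x) ⟩
  σ (½ * (x * R)) + σ A + ½ * (x * y)     ≈⟨ +-congʳ (½ * (x * y)) (+-cong (half (x * R) σ-xR) (≈-sym B≈σA)) ⟩
  ½ * (x * y * S) + B + ½ * (x * y)       ∎)
  where
  open ≈-Reasoning
  half : ∀ f {g} → σ f ≈ g → σ (½ * f) ≈ ½ * g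
  half f {g} σf≈g = ≈-trans (σ-* ½ f) (*-cong {σ ½} {½} {σ f} {g} (σ-const ℚ.½) σf≈g)

V-U-relation : (# 1 - y) * V-U ≈ rows recip₂ - y * (x + (# 1 - x) * A) - y * (# 0 - B - x * y)
V-U-relation = ≈-trans 1-y-*-V-U (-‿cong {rows recip₂ - y * ogf recip₂} {rows recip₂ - y * (x + (# 1 - x) * A)} {y * σ (ogf recip≥2)} {y * (# 0 - B - x * y)}
  (-‿cong {rows recip₂} {rows recip₂} {y * ogf recip₂} {y * (x + (# 1 - x) * A)} ≈-refl (*-congˡ y ogf-recip₂)) (*-congˡ y σ-recip≥2))

V-L-relation : V-L ≈ rows recip₂ - (x * y + (# 1 - x * y) * B)
V-L-relation = ≈-trans V-L≈ (-‿cong {rows recip₂} {rows recip₂} {σ (ogf recip₂)} {x * y + (# 1 - x * y) * B} ≈-refl σ-recip₂)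

p-relation : p * (# 2 * (# 1 - y)) ≈ # 1
p-relation = inverse-* (# 2 * (# 1 - y))

q-relation : q * (# 1 - y) ^ 2 ≈ # 1
q-relation = inverse-* ((# 1 - y) ^ 2)

closed-L closed-D closed-U : Series
closed-L =
      x * y
      + (# 2 * (x * y - y - # 1) * ln (# 1 - x * y)
         - # 2 * y * (x - # 2) * ln (# 1 - x)
         - y * (ln (# 1 - x * y) ^ 2 - ln (# 1 - x) ^ 2))
        / (# 2 * (# 1 - y))
closed-D =
      x * y / (# 2 * (# 1 - y))
        * ((# 3 * x - # 2) / (# 1 - x) - x * y ^ 2 / (# 1 - x * y))
      + ((# 1 - x * y) * ln (# 1 - x * y) - y * (# 2 - x - y) * ln (# 1 - x))
        / ((# 1 - y) ^ 2)
      + y * (ln (# 1 - x * y) ^ 2 - ln (# 1 - x) ^ 2) / (# 2 * (# 1 - y))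
closed-U =
      x * y / (# 2 * (# 1 - y))
        * ((# 2 - x) / (# 1 - x) - x * y ^ 2 / (# 1 - x * y))
      + y * (# 1 - x * y) / ((# 1 - y) ^ 2) * ln ((# 1 - x) / (# 1 - x * y))

#0 #1 #2 #3 #½ : ∀ {n} → Polynomial n
#0 = con 0ℚ
#1 = con 1ℚ
#2 = con (+ 2 ℚ./ 1)
#3 = con (+ 3 ℚ./ 1)
#½ = con ℚ.½

-- After multiplication by 2 (1 - y) the two sides differ by a combination of three relations, with
-- multipliers 2, 2 and -N: the inverse p occurs only in the product N p, where N is the numerator
-- of the fraction.
L-closed-form : ∀ t → (# 1 - x) * ogf t ≈ # 0 - A - x → rows (integral t) + V-L ≈ closed-L
L-closed-form t hyp = cancelˡ (# 2 * (# 1 - y)) {rows (integral t) + V-L} {closed-L} (begin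
  # 2 * (# 1 - y) * (rows (integral t) + V-L)
    ≈⟨ *-congˡ (# 2 * (# 1 - y)) (+-congˡ (rows (integral t)) V-L-relation) ⟩
  # 2 * (# 1 - y) * (rows (integral t) + (rows recip₂ - (x * y + (# 1 - x * y) * B)))
    ≈⟨ modulo (rows-L t hyp) _ _ (# 2) (modulo rows-recip₂ _ _ (# 2) (modulo p-relation _ _ (# 0 - N)
         (solve 7 (λ x y a b gl gv p →
            let n = #2 :* (x :* y :- y :- #1) :* b :- #2 :* y :* (x :- #2) :* a :- y :* (b :* (b :* #1) :- a :* (a :* #1)) in
              #2 :* (#1 :- y) :* (gl :+ (gv :- (x :* y :+ (#1 :- x :* y) :* b)))
              := #2 :* (#1 :- y) :* (x :* y :+ n :* p)
              :+ #2 :* ((#1 :- y) :* gl :- y :* (#½ :* (a :* a) :+ a :+ x :- (#½ :* (b :* b) :+ b :+ x :* y)))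
              :+ #2 :* ((#1 :- y) :* gv :- y :* (x :+ (#1 :- x) :* a :- (x :* y :+ (#1 :- x :* y) :* b)))
              :+ (#0 :- n) :* (p :* (#2 :* (#1 :- y)) :- #1))
           (λ _ _ → refl) x y A B (rows (integral t)) (rows recip₂) p))) ⟩
  # 2 * (# 1 - y) * closed-L ∎)
  where
  open ≈-Reasoning
  N = # 2 * (x * y - y - # 1) * B - # 2 * y * (x - # 2) * A - y * (B ^ 2 - A ^ 2)

-- `V-U` contains `rows recip₂`, which has the denominator 1 - y, divided by 1 - y once more; hence
-- the square. The solver sees only `A - B`, which is turned into the logarithm of the quotient at
-- the end.
U-closed-form : ∀ t → (# 1 - x) * ogf t ≈ ½ * (x * (x * R)) → rows (integral t) + V-U ≈ closed-U
U-closed-form t hyp = cancelˡ (# 2 * ((# 1 - y) * (# 1 - y))) {rows (integral t) + V-U} {closed-U} (begin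
  # 2 * ((# 1 - y) * (# 1 - y)) * (rows (integral t) + V-U)
    -- A relation for a multiple by 1 - y uses up one factor 1 - y of the clearing factor.
    -- `rows-recip₂` enters only through `V-U-relation`, where one is already spent, and so its
    -- multiplier is just 2.
    ≈⟨ modulo (rows-U t hyp) _ _ (# 2 * (# 1 - y)) (modulo V-U-relation _ _ (# 2 * (# 1 - y)) (modulo rows-recip₂ _ _ (# 2)
       (modulo p-relation _ _ (# 0 - (# 1 - y) * (x * y) * K) (modulo q-relation _ _ (# 0 - # 2 * (y * (# 1 - x * y) * (A - B)))
       (modulo R-relation _ _ (# 0 - (# 1 - y) * (x * y)) (modulo S-relation _ _ (# 0 - (# 1 - y) * (x * y * y))
         (solve 11 (λ x y a b recip s gu vu gv p q →
            let d = #1 :- y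
                k = (#2 :- x) :* recip :- x :* (y :* (y :* #1)) :* s in
              #2 :* (d :* d) :* (gu :+ vu)
              := #2 :* (d :* d) :* (x :* y :* p :* k :+ y :* (#1 :- x :* y) :* q :* (a :- b))
              :+ #2 :* d :* (d :* gu :- y :* (#½ :* (x :* recip) :+ a :+ #½ :* x :- (#½ :* (x :* y :* s) :+ b :+ #½ :* (x :* y))))
              :+ #2 :* d :* (d :* vu :- (gv :- y :* (x :+ (#1 :- x) :* a) :- y :* (#0 :- b :- x :* y)))
              :+ #2 :* (d :* gv :- y :* (x :+ (#1 :- x) :* a :- (x :* y :+ (#1 :- x :* y) :* b)))
              :+ (#0 :- d :* (x :* y) :* k) :* (p :* (#2 :* d) :- #1)
              :+ (#0 :- #2 :* (y :* (#1 :- x :* y) :* (a :- b))) :* (q :* (d :* (d :* #1)) :- #1)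
              :+ (#0 :- d :* (x :* y)) :* (recip :* (#1 :- x) :- #1)
              :+ (#0 :- d :* (x :* y :* y)) :* (s :* (#1 :- x :* y) :- #1))
           (λ _ _ → refl) x y A B R S (rows (integral t)) V-U (rows recip₂) p q))))))) ⟩
  # 2 * ((# 1 - y) * (# 1 - y)) * (x * y * p * K + y * (# 1 - x * y) * q * (A - B))
    ≈⟨ *-congˡ (# 2 * ((# 1 - y) * (# 1 - y))) (+-congˡ (x * y * p * K) (*-congˡ (y * (# 1 - x * y) * q) ln-quotient)) ⟨
  # 2 * ((# 1 - y) * (# 1 - y)) * closed-U ∎)
  where
  open ≈-Reasoning
  K = (# 2 - x) * R - x * y ^ 2 * S

D-closed-form : ∀ t u → (# 1 - x) * ogf t ≈ # 0 - A - x → (# 1 - x) * ogf u ≈ ½ * (x * (x * R)) →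
                rows ratio - (rows (integral t) + V-L) - (rows (integral u) + V-U) ≈ closed-D
D-closed-form t u hyp-t hyp-u = cancelˡ (# 2 * (d * d)) {F} {closed-D} (begin
  # 2 * (d * d) * F
    ≈⟨ *-congˡ (# 2 * (d * d)) (-‿cong {rows ratio - (rows (integral t) + V-L)} {rows ratio - (rows (integral t) + (rows recip₂ - (x * y + (# 1 - x * y) * B)))} {rows (integral u) + V-U} {rows (integral u) + V-U}
         (-‿cong {rows ratio} {rows ratio} {rows (integral t) + V-L} {rows (integral t) + (rows recip₂ - (x * y + (# 1 - x * y) * B))} ≈-refl (+-congˡ (rows (integral t)) V-L-relation)) ≈-refl) ⟩
  # 2 * (d * d) * (rows ratio - (rows (integral t) + (rows recip₂ - (x * y + (# 1 - x * y) * B))) - (rows (integral u) + V-U))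
    ≈⟨ modulo rows-ratio _ _ (# 2 * d) (modulo (rows-L t hyp-t) _ _ (# 0 - # 2 * d) (modulo (rows-U u hyp-u) _ _ (# 0 - # 2 * d)
       -- `rows recip₂` enters twice: through `V-L` with multiplier -2 d and through `V-U` with -2.
       (modulo V-U-relation _ _ (# 0 - # 2 * d) (modulo rows-recip₂ _ _ (# 0 - # 2 * d - # 2)
       (modulo p-relation _ _ (# 0 - d * (x * y * K + y * (B ^ 2 - A ^ 2))) (modulo q-relation _ _ (# 0 - # 2 * N)
       (modulo R-relation _ _ (# 3 * d * (x * y)) (modulo S-relation _ _ (# 0 - d * (x * y * y))
         (solve 13 (λ x y a b recip s gw gl gu vu gv p q →
            let d = #1 :- y
                k = (#3 :* x :- #2) :* recip :- x :* (y :* (y :* #1)) :* s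
                l = b :* (b :* #1) :- a :* (a :* #1)
                n = (#1 :- x :* y) :* b :- y :* (#2 :- x :- y) :* a in
              #2 :* (d :* d) :* (gw :- (gl :+ (gv :- (x :* y :+ (#1 :- x :* y) :* b))) :- (gu :+ vu))
              := #2 :* (d :* d) :* (x :* y :* p :* k :+ n :* q :+ y :* l :* p)
              :+ #2 :* d :* (d :* gw :- y :* (x :* recip :+ a :- (x :* y :* s :+ b)))
              :+ (#0 :- #2 :* d) :* (d :* gl :- y :* (#½ :* (a :* a) :+ a :+ x :- (#½ :* (b :* b) :+ b :+ x :* y)))
              :+ (#0 :- #2 :* d) :* (d :* gu :- y :* (#½ :* (x :* recip) :+ a :+ #½ :* x :- (#½ :* (x :* y :* s) :+ b :+ #½ :* (x :* y))))
              :+ (#0 :- #2 :* d) :* (d :* vu :- (gv :- y :* (x :+ (#1 :- x) :* a) :- y :* (#0 :- b :- x :* y)))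
              :+ (#0 :- #2 :* d :- #2) :* (d :* gv :- y :* (x :+ (#1 :- x) :* a :- (x :* y :+ (#1 :- x :* y) :* b)))
              :+ (#0 :- d :* (x :* y :* k :+ y :* l)) :* (p :* (#2 :* d) :- #1)
              :+ (#0 :- #2 :* n) :* (q :* (d :* (d :* #1)) :- #1)
              :+ #3 :* d :* (x :* y) :* (recip :* (#1 :- x) :- #1)
              :+ (#0 :- d :* (x :* y :* y)) :* (s :* (#1 :- x :* y) :- #1))
           (λ _ _ → refl) x y A B R S (rows ratio) (rows (integral t)) (rows (integral u)) V-U (rows recip₂) p q))))))))) ⟩
  # 2 * (d * d) * closed-D ∎)
  where
  open ≈-Reasoning
  F = rows ratio - (rows (integral t) + V-L) - (rows (integral u) + V-U)
  K = (# 3 * x - # 2) * R - x * y ^ 2 * S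
  N = (# 1 - x * y) * B - y * (# 2 - x - y) * A

-- Normalised totals and the comparison of coefficients.

/-unique : ∀ {s} z d .{{_ : ℕ.NonZero d}} → s ℚ.* ι d ≡ z ℚ./ 1 → s ≡ z ℚ./ d
/-unique {s} z d@(suc d-1) eq = begin
  s                            ≡⟨ unit s ⟨
  s ℚ.* ι d ℚ.* recip d            ≡⟨ cong (ℚ._* recip d) (trans eq (sym (/-cancel z d))) ⟩
  (z ℚ./ d) ℚ.* ι d ℚ.* recip d    ≡⟨ unit (z ℚ./ d) ⟩
  z ℚ./ d                      ∎
  where
  open ≡-Reasoning
  unit : ∀ s → s ℚ.* ι d ℚ.* recip d ≡ s
  unit s = trans (ℚ.*-assoc s (ι d) (recip d)) (trans (cong (s ℚ.*_) (ι*recip d-1)) (ℚ.*-identityʳ s))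

ι-* : ∀ m n → ι (m ℕ.* n) ≡ ι m ℚ.* ι n
ι-* zero    n = sym (ℚ.*-zeroˡ (ι n))
ι-* (suc m) n = begin
  ι (n ℕ.+ m ℕ.* n)          ≡⟨ ι-+ n (m ℕ.* n) ⟩
  ι n ℚ.+ ι (m ℕ.* n)        ≡⟨ cong (ι n ℚ.+_) (ι-* m n) ⟩
  ι n ℚ.+ ι m ℚ.* ι n        ≡⟨ ℚR.solve 2 (λ m n → n ℚR.:+ m ℚR.:* n ℚR.:= (ℚR.con 1ℚ ℚR.:+ m) ℚR.:* n) refl (ι m) (ι n) ⟩
  (1ℚ ℚ.+ ι m) ℚ.* ι n       ≡⟨ cong (ℚ._* ι n) (ι-+ 1 m) ⟨
  ι (suc m) ℚ.* ι n          ∎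
  where open ≡-Reasoning

-- 1/n! as a product of reciprocals, so that raising n by one multiplies by `recip (suc n)` by
-- computation.
recip! : ℕ → ℚ
recip! zero    = 1ℚ
recip! (suc n) = recip! n ℚ.* recip (suc n)

recip!-ι! : ∀ n → recip! n ℚ.* ι (n !) ≡ 1ℚ
recip!-ι! zero    = refl
recip!-ι! (suc n) = begin
  recip! n ℚ.* recip (suc n) ℚ.* ι (suc n ℕ.* n !)
    ≡⟨ cong (recip! n ℚ.* recip (suc n) ℚ.*_) (ι-* (suc n) (n !)) ⟩
  recip! n ℚ.* recip (suc n) ℚ.* (ι (suc n) ℚ.* ι (n !))
    ≡⟨ ℚR.solve 4 (λ a b c d → a ℚR.:* b ℚR.:* (c ℚR.:* d) ℚR.:= (a ℚR.:* d) ℚR.:* (c ℚR.:* b)) refl (recip! n) (recip (suc n)) (ι (suc n)) (ι (n !)) ⟩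
  (recip! n ℚ.* ι (n !)) ℚ.* (ι (suc n) ℚ.* recip (suc n))
    ≡⟨ cong₂ ℚ._*_ (recip!-ι! n) (ι*recip n) ⟩
  1ℚ ∎
  where open ≡-Reasoning

/! : ∀ k n → ℚ._/_ (+ k) (n !) {{n ℕ.!≢0}} ≡ ι k ℚ.* recip! n
/! k n = sym (/-unique (+ k) (n !) {{n ℕ.!≢0}} (trans (ℚ.*-assoc (ι k) (recip! n) (ι (n !)))
  (trans (cong (ι k ℚ.*_) (recip!-ι! n)) (ℚ.*-identityʳ (ι k)))))

module Normalised {R : ℕ → ℕ → Set} (R? : Decidable R) where
  open Adjacent R?

  t : ℕ → ℚ
  t n = ι (grandTotal n) ℚ.* recip! n

  private
    -- The factor n!/(n + 2)! is 1/((n + 2)(n + 1)), which is how `recip₂` enters.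
    expand : ∀ n a b → ι (a ℕ.+ n ! ℕ.* b) ℚ.* recip! (suc (suc n)) ≡
      ι a ℚ.* recip! (suc n) ℚ.* recip (suc (suc n)) ℚ.+ ι b ℚ.* recip₂ (suc (suc n))
    expand n a b = begin
      ι (a ℕ.+ n ! ℕ.* b) ℚ.* recip! (suc (suc n))
        ≡⟨ cong (ℚ._* recip! (suc (suc n))) (trans (ι-+ a (n ! ℕ.* b)) (cong (ι a ℚ.+_) (ι-* (n !) b))) ⟩
      (ι a ℚ.+ ι (n !) ℚ.* ι b) ℚ.* (recip! n ℚ.* recip (suc n) ℚ.* recip (suc (suc n)))
        ≡⟨ ℚR.solve 6 (λ a f b g recip s → (a ℚR.:+ f ℚR.:* b) ℚR.:* (g ℚR.:* recip ℚR.:* s)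
             ℚR.:= a ℚR.:* (g ℚR.:* recip) ℚR.:* s ℚR.:+ (g ℚR.:* f) ℚR.:* (b ℚR.:* (s ℚR.:* recip))) refl
             (ι a) (ι (n !)) (ι b) (recip! n) (recip (suc n)) (recip (suc (suc n))) ⟩
      ι a ℚ.* recip! (suc n) ℚ.* recip (suc (suc n)) ℚ.+ recip! n ℚ.* ι (n !) ℚ.* (ι b ℚ.* recip₂ (suc (suc n)))
        ≡⟨ cong (λ q → ι a ℚ.* recip! (suc n) ℚ.* recip (suc (suc n)) ℚ.+ q)
             (trans (cong (ℚ._* (ι b ℚ.* recip₂ (suc (suc n)))) (recip!-ι! n)) (ℚ.*-identityˡ _)) ⟩
      ι a ℚ.* recip! (suc n) ℚ.* recip (suc (suc n)) ℚ.+ ι b ℚ.* recip₂ (suc (suc n)) ∎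
      where open ≡-Reasoning

  t-suc : ∀ n → t (suc (suc n)) ℚ.- t (suc n) ≡ ι (pairs (suc n)) ℚ.* recip₂ (suc (suc n))
  t-suc n = begin
    ι (grandTotal (suc (suc n))) ℚ.* recip! (suc (suc n)) ℚ.- t (suc n)
      ≡⟨ cong (λ k → ι k ℚ.* recip! (suc (suc n)) ℚ.- t (suc n)) (grandTotal-suc n) ⟩
    ι (suc (suc n) ℕ.* grandTotal (suc n) ℕ.+ n ! ℕ.* pairs (suc n)) ℚ.* recip! (suc (suc n)) ℚ.- t (suc n)
      ≡⟨ cong (ℚ._- t (suc n)) (expand n (suc (suc n) ℕ.* grandTotal (suc n)) (pairs (suc n))) ⟩
    ι (suc (suc n) ℕ.* grandTotal (suc n)) ℚ.* f ℚ.* s ℚ.+ δ ℚ.- t (suc n)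
      ≡⟨ cong (λ q → q ℚ.* f ℚ.* s ℚ.+ δ ℚ.- t (suc n)) (ι-* (suc (suc n)) (grandTotal (suc n))) ⟩
    ι (suc (suc n)) ℚ.* g ℚ.* f ℚ.* s ℚ.+ δ ℚ.- t (suc n)
      ≡⟨ ℚR.solve 5 (λ i g f s δ → i ℚR.:* g ℚR.:* f ℚR.:* s ℚR.:+ δ ℚR.:- g ℚR.:* f
                               ℚR.:= (i ℚR.:* s) ℚR.:* (g ℚR.:* f) ℚR.:+ δ ℚR.:- g ℚR.:* f) refl
           (ι (suc (suc n))) g f s δ ⟩
    (ι (suc (suc n)) ℚ.* s) ℚ.* t (suc n) ℚ.+ δ ℚ.- t (suc n)
      ≡⟨ cong (λ q → q ℚ.* t (suc n) ℚ.+ δ ℚ.- t (suc n)) (ι*recip (suc n)) ⟩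
    1ℚ ℚ.* t (suc n) ℚ.+ δ ℚ.- t (suc n)
      ≡⟨ ℚR.solve 2 (λ t δ → ℚR.con 1ℚ ℚR.:* t ℚR.:+ δ ℚR.:- t ℚR.:= δ) refl (t (suc n)) δ ⟩
    δ ∎
    where
    open ≡-Reasoning
    f = recip! (suc n)
    s = recip (suc (suc n))
    g = ι (grandTotal (suc n))
    δ = ι (pairs (suc n)) ℚ.* recip₂ (suc (suc n))

  -- A total over sequences of length n + 1 is divided by (n + 2)!; the surplus factor 1/(n + 2) is
  -- the one that integration produces.
  egf-coefficient : ∀ n m → m ℕ.≤ suc n →
    ι (total (I (suc (suc n)) (suc m)) count) ℚ.* recip! (suc (suc n)) ≡
    integral t (suc (suc n)) ℚ.+ ι (sum< (suc n) λ k → holds (suc k) (suc m)) ℚ.* recip₂ (suc (suc n))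
  egf-coefficient n m m≤1+n = trans
    (cong (λ k → ι k ℚ.* recip! (suc (suc n))) (total-I-count n m m≤1+n))
    (trans (expand n (grandTotal (suc n)) (sum< (suc n) λ k → holds (suc k) (suc m)))
      (cong (ℚ._+ ι (sum< (suc n) λ k → holds (suc k) (suc m)) ℚ.* recip₂ (suc (suc n))) (ℚ.*-comm (t (suc n)) (recip (suc (suc n))))))

module LevelTotals = Normalised ℕ._≟_
module AscentTotals = Normalised ℕ._<?_

<ᵇ-suc : ∀ m n → (m ℕ.<ᵇ suc n) ≡ true → m ℕ.≤ n
<ᵇ-suc m n eq = ℕ.≤-pred (ℕ.<ᵇ⇒< m (suc n) (≡.subst T (sym eq) _))

<ᵇ-false : ∀ m n → (m ℕ.<ᵇ suc n) ≡ false → (m ℕ.<ᵇ n) ≡ false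
<ᵇ-false m       zero    eq = refl
<ᵇ-false (suc m) (suc n) eq = <ᵇ-false m n eq

if-cases : ∀ b {p q : ℚ} → (b ≡ true → p ≡ q) → (b ≡ false → 0ℚ ≡ q) → (if b then p else 0ℚ) ≡ q
if-cases true  p≡q _   = p≡q refl
if-cases false _   0≡q = 0≡q refl

below-true : ∀ n {q} m → (m ℕ.<ᵇ n) ≡ true → below n q m ≡ q
below-true n {q} m eq = cong (λ b → if b then q else 0ℚ) eq

below-false : ∀ n {q} m → (m ℕ.<ᵇ n) ≡ false → below n q m ≡ 0ℚ
below-false n {q} m eq = cong (λ b → if b then q else 0ℚ) eq

egf-L : egf L ≈ rows (integral LevelTotals.t) + V-L
egf-L zero          zero    = refl
egf-L zero          (suc m) = refl
egf-L (suc n)       zero    = refl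
egf-L (suc zero)    (suc zero) = refl
egf-L (suc zero)    (suc (suc m)) = refl
-- The test `suc m ≤ᵇ suc (suc n)` in `egf` reduces to `m <ᵇ suc (suc n)`, the test of `below`, so
-- one case distinction serves both sides.
egf-L (suc (suc n)) (suc m) = if-cases (m ℕ.<ᵇ suc (suc n))
  (λ eq → begin
    ℚ._/_ (+ L (suc (suc n)) (suc m)) (suc (suc n) !) {{suc (suc n) ℕ.!≢0}}
      ≡⟨ /! (L (suc (suc n)) (suc m)) (suc (suc n)) ⟩
    ι (L (suc (suc n)) (suc m)) ℚ.* recip! (suc (suc n))
      ≡⟨ LevelTotals.egf-coefficient n m (<ᵇ-suc m (suc n) eq) ⟩
    i ℚ.+ ι (sum< (suc n) λ k → Levels.holds (suc k) (suc m)) ℚ.* recip₂ (suc (suc n))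
      ≡⟨ cong (λ k → i ℚ.+ ι k ℚ.* recip₂ (suc (suc n))) (sum<-levels (suc n) m) ⟩
    i ℚ.+ ι (if m ℕ.<ᵇ suc n then 1 else 0) ℚ.* recip₂ (suc (suc n))
      ≡⟨ cong₂ ℚ._+_ (sym (below-true (suc (suc n)) m eq)) (indicator (m ℕ.<ᵇ suc n)) ⟩
    below (suc (suc n)) i m ℚ.+ below (suc n) (recip₂ (suc (suc n))) m ∎)
  (λ eq → sym (cong₂ ℚ._+_ (below-false (suc (suc n)) m eq) (below-false (suc n) m (<ᵇ-false m (suc n) eq))))
  where
  open ≡-Reasoning
  i = integral LevelTotals.t (suc (suc n))
  indicator : ∀ b → ι (if b then 1 else 0) ℚ.* recip₂ (suc (suc n)) ≡ (if b then recip₂ (suc (suc n)) else 0ℚ)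
  indicator true  = ℚ.*-identityˡ (recip₂ (suc (suc n)))
  indicator false = ℚ.*-zeroˡ (recip₂ (suc (suc n)))

egf-U : egf U ≈ rows (integral AscentTotals.t) + V-U
egf-U zero          zero    = refl
egf-U zero          (suc m) = refl
egf-U (suc n)       zero    = refl
egf-U (suc zero)    (suc zero) = refl
egf-U (suc zero)    (suc (suc m)) = refl
egf-U (suc (suc n)) (suc m) = if-cases (m ℕ.<ᵇ suc (suc n))
  (λ eq → begin
    ℚ._/_ (+ U (suc (suc n)) (suc m)) (suc (suc n) !) {{suc (suc n) ℕ.!≢0}}
      ≡⟨ /! (U (suc (suc n)) (suc m)) (suc (suc n)) ⟩
    ι (U (suc (suc n)) (suc m)) ℚ.* recip! (suc (suc n))
      ≡⟨ AscentTotals.egf-coefficient n m (<ᵇ-suc m (suc n) eq) ⟩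
    i ℚ.+ ι (sum< (suc n) λ k → Ascents.holds (suc k) (suc m)) ℚ.* recip₂ (suc (suc n))
      ≡⟨ cong (λ k → i ℚ.+ ι k ℚ.* recip₂ (suc (suc n))) (sum<-ascents (suc n) m (<ᵇ-suc m (suc n) eq)) ⟩
    i ℚ.+ ι m ℚ.* recip₂ (suc (suc n))
      ≡⟨ cong₂ ℚ._+_ (below-true (suc (suc n)) m eq) (below-true (suc (suc n)) m eq) ⟨
    below (suc (suc n)) i m ℚ.+ below (suc (suc n)) (ι m ℚ.* recip₂ (suc (suc n))) m ∎)
  (λ eq → sym (cong₂ ℚ._+_ (below-false (suc (suc n)) m eq) (below-false (suc (suc n)) m eq)))
  where
  open ≡-Reasoning
  i = integral AscentTotals.t (suc (suc n))

egf-D : egf D ≈ rows ratio - egf L - egf U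
egf-D zero    zero    = refl
egf-D zero    (suc m) = refl
egf-D (suc n) zero    = refl
egf-D (suc n) (suc m) = if-cases (m ℕ.<ᵇ suc n)
  (λ eq → begin
    ℚ._/_ (+ D′) (suc n !) {{suc n ℕ.!≢0}}
      ≡⟨ /! D′ (suc n) ⟩
    ι D′ ℚ.* f
      ≡⟨ ℚR.solve 4 (λ l d u f → d ℚR.:* f ℚR.:= (l ℚR.:+ d ℚR.:+ u) ℚR.:* f ℚR.:- l ℚR.:* f ℚR.:- u ℚR.:* f) refl
           (ι L′) (ι D′) (ι U′) f ⟩
    (ι L′ ℚ.+ ι D′ ℚ.+ ι U′) ℚ.* f ℚ.- ι L′ ℚ.* f ℚ.- ι U′ ℚ.* f
      ≡⟨ cong (λ q → q ℚ.- ι L′ ℚ.* f ℚ.- ι U′ ℚ.* f) (trans (cong (ℚ._* f) (totals (<ᵇ-suc m n eq))) length) ⟩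
    ratio (suc n) ℚ.- ι L′ ℚ.* f ℚ.- ι U′ ℚ.* f
      ≡⟨ cong₂ ℚ._-_ (cong₂ ℚ._-_ (below-true (suc n) m eq)
           (trans (below-true (suc n) m eq) (/! L′ (suc n)))) (trans (below-true (suc n) m eq) (/! U′ (suc n))) ⟨
    rows ratio (suc n) (suc m) ℚ.- egf L (suc n) (suc m) ℚ.- egf U (suc n) (suc m) ∎)
  (λ eq → sym (cong₂ ℚ._-_ (cong₂ ℚ._-_ (below-false (suc n) m eq) (below-false (suc n) m eq)) (below-false (suc n) m eq)))
  where
  open ≡-Reasoning
  L′ = L (suc n) (suc m)
  D′ = D (suc n) (suc m)
  U′ = U (suc n) (suc m)
  f = recip! (suc n)
  totals : m ℕ.≤ n → ι L′ ℚ.+ ι D′ ℚ.+ ι U′ ≡ ι (n !) ℚ.* ι n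
  totals m≤n = trans (sym (trans (ι-+ (L′ ℕ.+ D′) U′) (cong (ℚ._+ ι U′) (ι-+ L′ D′))))
    (trans (cong ι (L+D+U n m m≤n)) (ι-* (n !) n))
  length : ι (n !) ℚ.* ι n ℚ.* f ≡ ι n ℚ.* recip (suc n)
  length = trans
    (ℚR.solve 4 (λ a b c d → a ℚR.:* b ℚR.:* (c ℚR.:* d) ℚR.:= (c ℚR.:* a) ℚR.:* (b ℚR.:* d)) refl (ι (n !)) (ι n) (recip! n) (recip (suc n)))
    (trans (cong (ℚ._* (ι n ℚ.* recip (suc n))) (recip!-ι! n)) (ℚ.*-identityˡ _))

tL-relation : (# 1 - x) * ogf LevelTotals.t ≈ # 0 - A - x
tL-relation = ≈-trans coefficients ogf-recip≥2
  where
  coefficients : (# 1 - x) * ogf LevelTotals.t ≈ ogf recip≥2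
  coefficients zero zero = 1-x-*-zero (ogf LevelTotals.t) 0
  coefficients zero (suc m) = 1-x-*-zero (ogf LevelTotals.t) (suc m)
  coefficients (suc zero) zero = 1-x-*-suc (ogf LevelTotals.t) 0 0
  coefficients (suc (suc n)) zero = trans (1-x-*-suc (ogf LevelTotals.t) (suc n) 0)
    (trans (LevelTotals.t-suc n) (cong (λ k → ι k ℚ.* recip₂ (suc (suc n))) (pairs-levels (suc n))))
  coefficients (suc n) (suc m) = 1-x-*-suc (ogf LevelTotals.t) n (suc m)

-- Multiplication by 1 - x takes differences. They vanish for n ≤ 1, since a single letter forms no
-- pair; hence the factor x² in front of `R`.
tU-relation : (# 1 - x) * ogf AscentTotals.t ≈ ½ * (x * (x * R))
tU-relation = ≈-trans coefficients (*-congˡ ½ (*-congˡ x (*-congˡ x (≈-sym R≈ogf))))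
  where
  g = ogf λ _ → 1ℚ
  rhs : ∀ n m → (½ * (x * (x * g))) n m ≡ ℚ.½ ℚ.* (x * (x * g)) n m
  rhs = const-* ℚ.½ (x * (x * g))
  coefficients : (# 1 - x) * ogf AscentTotals.t ≈ ½ * (x * (x * g))
  coefficients zero m = trans (1-x-*-zero (ogf AscentTotals.t) m) (trans (row₀ m) (sym (trans (rhs 0 m) (cong (ℚ.½ ℚ.*_) (x-*-zero (x * g) m)))))
    where
    row₀ : ∀ m → ogf AscentTotals.t 0 m ≡ 0ℚ
    row₀ zero    = refl
    row₀ (suc m) = refl
  coefficients (suc zero) m = trans (1-x-*-suc (ogf AscentTotals.t) 0 m) (trans (row₁ m)
      (sym (trans (rhs 1 m) (cong (ℚ.½ ℚ.*_) (trans (x-*-suc (x * g) 0 m) (x-*-zero g m))))))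
    where
    row₁ : ∀ m → ogf AscentTotals.t 1 m ℚ.- ogf AscentTotals.t 0 m ≡ 0ℚ
    row₁ zero    = refl
    row₁ (suc m) = refl
  coefficients (suc (suc n)) m = trans (1-x-*-suc (ogf AscentTotals.t) (suc n) m) (trans (row m)
      (sym (trans (rhs (suc (suc n)) m) (cong (ℚ.½ ℚ.*_) (trans (x-*-suc (x * g) (suc n) m) (x-*-suc g n m))))))
    where
    open ≡-Reasoning
    E = ι (Ascents.pairs (suc n))
    a = recip (suc n)
    b = recip (suc (suc n))
    row : ∀ m → ogf AscentTotals.t (suc (suc n)) m ℚ.- ogf AscentTotals.t (suc n) m ≡ ℚ.½ ℚ.* g n m
    row zero    = begin
      AscentTotals.t (suc (suc n)) ℚ.- AscentTotals.t (suc n)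
        ≡⟨ AscentTotals.t-suc n ⟩
      E ℚ.* (b ℚ.* a)
        -- A factor ½ · 2 is inserted because `2*pairs-ascents` evaluates only the doubled number of
        -- pairs.
        ≡⟨ ℚR.solve 3 (λ e b a → e ℚR.:* (b ℚR.:* a) ℚR.:= ℚR.con ℚ.½ ℚR.:* ((ℚR.con (ι 2) ℚR.:* e) ℚR.:* (b ℚR.:* a))) refl E b a ⟩
      ℚ.½ ℚ.* (ι 2 ℚ.* E ℚ.* (b ℚ.* a))
        ≡⟨ cong (λ q → ℚ.½ ℚ.* (q ℚ.* (b ℚ.* a))) (trans (sym (ι-* 2 (Ascents.pairs (suc n))))
             (trans (cong ι (2*pairs-ascents (suc n))) (ι-* (suc n) (suc (suc n))))) ⟩
      ℚ.½ ℚ.* (ι (suc n) ℚ.* ι (suc (suc n)) ℚ.* (b ℚ.* a))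
        ≡⟨ cong (ℚ.½ ℚ.*_) (ℚR.solve 4 (λ i j b a → i ℚR.:* j ℚR.:* (b ℚR.:* a) ℚR.:= (i ℚR.:* a) ℚR.:* (j ℚR.:* b)) refl
             (ι (suc n)) (ι (suc (suc n))) b a) ⟩
      ℚ.½ ℚ.* ((ι (suc n) ℚ.* a) ℚ.* (ι (suc (suc n)) ℚ.* b))
        ≡⟨ cong (ℚ.½ ℚ.*_) (cong₂ ℚ._*_ (ι*recip n) (ι*recip (suc n))) ⟩
      ℚ.½ ℚ.* 1ℚ ∎
    row (suc m) = refl

theorem3p4 :
  (egf L ≈
    x * y
    + (# 2 * (x * y - y - # 1) * ln (# 1 - x * y)
       - # 2 * y * (x - # 2) * ln (# 1 - x)
       - y * (ln (# 1 - x * y) ^ 2 - ln (# 1 - x) ^ 2))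
      / (# 2 * (# 1 - y)))
  ×
  (egf D ≈
    x * y / (# 2 * (# 1 - y))
      * ((# 3 * x - # 2) / (# 1 - x) - x * y ^ 2 / (# 1 - x * y))
    + ((# 1 - x * y) * ln (# 1 - x * y) - y * (# 2 - x - y) * ln (# 1 - x))
      / ((# 1 - y) ^ 2)
    + y * (ln (# 1 - x * y) ^ 2 - ln (# 1 - x) ^ 2) / (# 2 * (# 1 - y)))
  ×
  (egf U ≈
    x * y / (# 2 * (# 1 - y))
      * ((# 2 - x) / (# 1 - x) - x * y ^ 2 / (# 1 - x * y))
    + y * (# 1 - x * y) / ((# 1 - y) ^ 2) * ln ((# 1 - x) / (# 1 - x * y)))
theorem3p4 =
    ≈-trans egf-L (L-closed-form LevelTotals.t tL-relation)
  , ≈-trans egf-D (≈-trans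
      (-‿cong {rows ratio - egf L} {rows ratio - (rows (integral LevelTotals.t) + V-L)} {egf U} {rows (integral AscentTotals.t) + V-U}
        (-‿cong {rows ratio} {rows ratio} {egf L} {rows (integral LevelTotals.t) + V-L} ≈-refl egf-L) egf-U)
      (D-closed-form LevelTotals.t AscentTotals.t tL-relation tU-relation))
  , ≈-trans egf-U (U-closed-form AscentTotals.t tU-relation)
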